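{- Let $t\ge2$, $\omega$ a primitive $t$-th root of unity, $n\ge1$, $X=(x_1,\dots,x_n)$, $\overline X=(1/x_1,\dots,1/x_n)$, $\widetilde X=(X,\overline X)$. Let $\mu\in\mathcal P_{tn}$ and $\lambda=(\pm\mu)_{2tn}$. Then \[ s_\lambda(\widetilde X,\omega\widetilde X,\dots,\omega^{t-1}\widetilde X)=(-1)^{|\mu|}\,\mathrm{oo}_\mu(X,\omega X,\dots,\omega^{t-1}X)\;\mathrm{oo}_\mu(-X,-\omega X,\dots,-\omega^{t-1}X). \]
   Context: Partitions $\mu=(\mu_1\ge\mu_2\ge\dots\ge0)$, $\ell(\mu)$ = number of nonzero parts, $|\mu|=\sum\mu_i$, $\mathcal P_m$ = partitions with $\ell\le m$. $h_k$ is the complete homogeneous symmetric polynomial ($h_0=1$, $h_k=0$ for $k<0$); for $\lambda\in\mathcal P_N$ and $N$ variables, $s_\lambda(Z)=\det(h_{\lambda_i-i+j}(Z))_{1\le i,j\le N}$. For $2\ell(\mu)\le N$, $(\pm\mu)_N$ denotes the partition $\mu_1+(\mu_1,\dots,\mu_{\ell(\mu)},0,\dots,0,-\mu_{\ell(\mu)},\dots,-\mu_1)$ of length $N$. For $k$ variables $W$, $\overline W=(1/w_1,\dots,1/w_k)$ and $\lambda\in\mathcal P_k$: $\mathrm{oo}_\lambda(W)=\det(h_{\lambda_i-i+j}(W,\overline W,1)-h_{\lambda_i-i-j}(W,\overline W,1))_{1\le i,j\le k}$. $cX=(cx_1,\dots,cx_n)$. -}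

module Defs where

open import Level using (Level)
open import Algebra.Bundles using (CommutativeRing)
open import Data.Nat as ℕ using (ℕ; zero; suc; _∸_)
open import Data.Integer as ℤ using (ℤ; +_; -[1+_])
open import Data.Fin using (Fin; zero; suc; toℕ; punchIn; splitAt; opposite)
open import Data.Sum using (inj₁; inj₂)
open import Data.List as List using (List; []; _∷_; _++_)
open import Relation.Nullary using (¬_)
open import Data.Product using (∃)
open import Data.Nat.ListAction using () renaming (sum to sumL)

-- Weakly decreasing sequences of length m (with trailing zeros): the set P_m.
IsPartition : (m : ℕ) → (Fin m → ℕ) → Set
IsPartition m μ = (i j : Fin m) → toℕ i ℕ.≤ toℕ j → μ j ℕ.≤ μ i

size : (m : ℕ) → (Fin m → ℕ) → ℕ
size m μ = sumL (List.tabulate μ)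

firstPart : (m : ℕ) → (Fin m → ℕ) → ℕ
firstPart zero μ = 0
firstPart (suc m) μ = μ zero

pmPart : (m : ℕ) → (Fin m → ℕ) → Fin (m ℕ.+ m) → ℤ
pmPart m μ i with splitAt m i
... | inj₁ k = + (firstPart m μ) ℤ.+ + (μ k)
... | inj₂ k = + (firstPart m μ) ℤ.- + (μ (opposite k))

module _ {c ℓ : Level} (R : CommutativeRing c ℓ) where
  open CommutativeRing R hiding (zero)

  pow : Carrier → ℕ → Carrier
  pow a zero = 1#
  pow a (suc k) = a * pow a k

  sumF : (n : ℕ) → (Fin n → Carrier) → Carrier
  sumF zero f = 0#
  sumF (suc n) f = f zero + sumF n (λ i → f (suc i))

  det : (n : ℕ) → (Fin n → Fin n → Carrier) → Carrier
  det zero M = 1#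
  det (suc n) M =
    sumF (suc n) (λ j → pow (- 1#) (toℕ j) * (M zero j * det n (λ a b → M (suc a) (punchIn j b))))

  hℕ : ℕ → List Carrier → Carrier
  hℕ zero [] = 1#
  hℕ (suc k) [] = 0#
  hℕ k (z ∷ zs) = sumF (suc k) (λ j → pow z (toℕ j) * hℕ (k ∸ toℕ j) zs)

  h : ℤ → List Carrier → Carrier
  h (+ k) zs = hℕ k zs
  h -[1+ k ] zs = 0#

  -- s_λ(Z) = det (h_{λ_i - i + j}(Z))_{1≤i,j≤N}  (index shift cancels when 0-indexed)
  schur : (N : ℕ) → (Fin N → ℤ) → List Carrier → Carrier
  schur N lam Z = det N (λ i j → h (lam i ℤ.- + toℕ i ℤ.+ + toℕ j) Z)

  -- oo_λ(W) = det (h_{λ_i-i+j}(W,W̄,1) - h_{λ_i-i-j}(W,W̄,1))_{1≤i,j≤k},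
  -- where the list Wbar of reciprocals 1/w_i is supplied explicitly.
  -- With 0-indexed i,j the second index λ_i-(i+1)-(j+1) = λ_i - i - j - 2.
  oo : (k : ℕ) → (Fin k → ℕ) → List Carrier → List Carrier → Carrier
  oo k lam W Wbar = det k (λ i j →
      h (+ lam i ℤ.- + toℕ i ℤ.+ + toℕ j) V
    - h (+ lam i ℤ.- + toℕ i ℤ.- + toℕ j ℤ.- + 2) V)
    where
    V : List Carrier
    V = W ++ Wbar ++ (1# ∷ [])

  scale : Carrier → List Carrier → List Carrier
  scale a = List.map (a *_)

  powBlocks : (t : ℕ) → Carrier → List Carrier → List Carrier
  powBlocks t c Z = List.concat (List.map (λ a → scale (pow c a) Z) (List.upTo t))

  IsFieldR : Set (c Level.⊔ ℓ)
  IsFieldR = (¬ (1# ≈ 0#)) Data.Product.× ((a : Carrier) → ¬ (a ≈ 0#) → ∃ λ b → a * b ≈ 1#)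

  IsPrimitiveRoot : ℕ → Carrier → Set ℓ
  IsPrimitiveRoot t ω = (pow ω t ≈ 1#) Data.Product.× ((k : ℕ) → 0 ℕ.< k → k ℕ.< t → ¬ (pow ω k ≈ 1#))

{-# OPTIONS --safe #-}

-- Put m = tn, W = (X, ωX, …, ω^(t−1)X), and let h be the complete homogeneous polynomials in W and W̄.
-- Inversion permutes the t-th roots of unity, so the Schur function is taken in the variables (W, W̄).
-- Write A = (h_{μᵢ−i+j}) and B = (h_{μᵢ−i−j+1}), 1 ≤ i, j ≤ m.  Subtracting neighbouring columns gives
-- oo_μ(W) = det(A + B), and h_k(−Z) = (−1)^k h_k(Z) gives oo_μ(−W) = (−1)^|μ| det(A − B).
-- The polynomial ∏ (x − w)(x − 1/w) is palindromic of degree 2m, so g_k = h_k − h_{−2m−k} extends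
-- (h_k)_{k > −2m} to a solution on ℤ of the corresponding recurrence, with g_{−2m−k} = −g_k.  The companion matrix
-- has determinant 1, so the columns of the 2m × 2m Jacobi–Trudi determinant may be shifted together by μ₁ + m;
-- up to reversals it is then det [[B, A], [−A, −B]] = det(A + B) det(A − B).
module Submission where

open import Defs
open import Level using (Level)
open import Algebra.Bundles using (CommutativeRing; CommutativeMonoid)
open import Algebra.Solver.Ring.AlmostCommutativeRing using (fromCommutativeRing; _-Raw-AlmostCommutative⟶_)
open import Data.Empty using (⊥-elim)
open import Data.Fin as Fin using (Fin; zero; suc; toℕ; punchIn; _↑ˡ_; _↑ʳ_; opposite; splitAt)
import Data.Fin.Properties as Fin
open import Data.Integer as ℤ using (ℤ; +_; -[1+_])
import Data.Integer.Properties as ℤ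
import Data.Integer.Solver as ℤ
open import Data.List as List using (List; []; _∷_; _++_; length; tabulate)
import Data.List.Properties as List
open import Data.List.Relation.Binary.Pointwise as Pointwise using (Pointwise; []; _∷_)
open import Data.Maybe as Maybe using ()
open import Data.Nat as ℕ using (ℕ; zero; suc; z≤n; s≤s)
import Data.Nat.Properties as ℕ
open import Data.Product using (∃; _×_; _,_; proj₁; proj₂)
open import Data.Sum using ([_,_]′; inj₁; inj₂)
open import Data.Vec.Functional using (insertAt; updateAt)
open import Data.Vec.Functional.Properties using (updateAt-updates; updateAt-minimal)
open import Function using (_∘_)
open import Relation.Nullary using (yes; no)
open import Relation.Nullary.Decidable using (dec⇒maybe)
open import Relation.Binary.PropositionalEquality as ≡ using (_≡_; _≢_)

-- The obstacle is that h vanishes at negative indices: this breaks the recurrence at exactly one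
-- place, k = -2m, where the sum is h_0 = 1 instead of 0, so the columns cannot be shifted as they
-- stand. The Jacobi-Trudi matrix contains only indices above -2m, where the reflected term is 0, so
-- replacing h by g does not change it. After the shift some lower entries have indices below that
-- range, and the antisymmetry of g makes the lower rows the negatives of the upper ones read
-- backwards. This dictates the amount of the shift: μ₁ removes the constant added in (±μ), and m
-- moves the centre of the matrix to the fixed point -m of the reflection.

-- A ring solver with integer coefficients.

module IntegerCoefficients {c ℓ : Level} (R : CommutativeRing c ℓ) where
  open CommutativeRing R hiding (zero)
  open import Algebra.Properties.Ring ring using (-‿distribˡ-*; -‿distribʳ-*)
  open import Algebra.Properties.AbelianGroup +-abelianGroup using (⁻¹-∙-comm; ⁻¹-involutive; ε⁻¹≈ε)
  open import Algebra.Properties.Monoid.Mult.TCOptimised +-monoid using (×-homo-+; 1+×) renaming (_×_ to _·_)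
  open import Algebra.Properties.Semiring.Mult.TCOptimised semiring using (×1-homo-*)
  open import Relation.Binary.Reasoning.Setoid setoid

  -- Equality in the ring is not decidable, so the solver normalises with coefficients in ℤ, where
  -- cancellation can be decided. The multiples are the optimised ones, with `1 · 1#` reducing to
  -- `1#`, so that `con (+ 1)` matches a literal `1#` by `refl`.
  ⟦_⟧ℤ : ℤ → Carrier
  ⟦ + n ⟧ℤ = n · 1#
  ⟦ -[1+ n ] ⟧ℤ = - (suc n · 1#)

  private
    cancel-1 : ∀ a b → a - b ≈ (1# + a) - (1# + b)
    cancel-1 a b = sym (begin
      (1# + a) - (1# + b)     ≈⟨ +-cong (+-comm 1# a) (sym (⁻¹-∙-comm 1# b)) ⟩
      (a + 1#) + (- 1# - b)   ≈⟨ +-assoc a 1# _ ⟩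
      a + (1# + (- 1# - b))   ≈⟨ +-congˡ (sym (+-assoc 1# _ _)) ⟩
      a + (1# - 1# - b)       ≈⟨ +-congˡ (+-congʳ (-‿inverseʳ 1#)) ⟩
      a + (0# - b)            ≈⟨ +-congˡ (+-identityˡ _) ⟩
      a - b                   ∎)

    ⊖-homo : ∀ m n → ⟦ m ℤ.⊖ n ⟧ℤ ≈ m · 1# - n · 1#
    ⊖-homo zero zero = sym (-‿inverseʳ 0#)
    ⊖-homo zero (suc n) = sym (+-identityˡ _)
    ⊖-homo (suc m) zero = sym (trans (+-congˡ ε⁻¹≈ε) (+-identityʳ _))
    ⊖-homo (suc m) (suc n) = begin
      ⟦ suc m ℤ.⊖ suc n ⟧ℤ             ≡⟨ ≡.cong ⟦_⟧ℤ (ℤ.[1+m]⊖[1+n]≡m⊖n m n) ⟩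
      ⟦ m ℤ.⊖ n ⟧ℤ                     ≈⟨ ⊖-homo m n ⟩
      m · 1# - n · 1#                  ≈⟨ cancel-1 _ _ ⟩
      (1# + m · 1#) - (1# + n · 1#)    ≈⟨ +-cong (sym (1+× m 1#)) (-‿cong (sym (1+× n 1#))) ⟩
      suc m · 1# - suc n · 1#          ∎

    -‿homo : ∀ i → ⟦ ℤ.- i ⟧ℤ ≈ - ⟦ i ⟧ℤ
    -‿homo (+ zero) = sym ε⁻¹≈ε
    -‿homo (+ suc n) = refl
    -‿homo -[1+ n ] = sym (⁻¹-involutive _)

    +-homo : ∀ i j → ⟦ i ℤ.+ j ⟧ℤ ≈ ⟦ i ⟧ℤ + ⟦ j ⟧ℤ
    +-homo (+ m) (+ n) = ×-homo-+ 1# m n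
    +-homo (+ m) -[1+ n ] = ⊖-homo m (suc n)
    +-homo -[1+ m ] (+ n) = trans (⊖-homo n (suc m)) (+-comm _ _)
    +-homo -[1+ m ] -[1+ n ] = begin
      - (suc (suc (m ℕ.+ n)) · 1#)       ≡⟨ ≡.cong (λ k → - (suc k · 1#)) (≡.sym (ℕ.+-suc m n)) ⟩
      - ((suc m ℕ.+ suc n) · 1#)         ≈⟨ -‿cong (×-homo-+ 1# (suc m) (suc n)) ⟩
      - (suc m · 1# + suc n · 1#)        ≈⟨ sym (⁻¹-∙-comm _ _) ⟩
      - (suc m · 1#) - suc n · 1#        ∎

    *-homo⁺ : ∀ m j → ⟦ + m ℤ.* j ⟧ℤ ≈ m · 1# * ⟦ j ⟧ℤ
    *-homo⁺ m (+ n) = begin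
      ⟦ + m ℤ.* + n ⟧ℤ    ≡⟨ ≡.cong ⟦_⟧ℤ (≡.sym (ℤ.pos-* m n)) ⟩
      (m ℕ.* n) · 1#      ≈⟨ ×1-homo-* m n ⟩
      m · 1# * n · 1#     ∎
    *-homo⁺ m -[1+ n ] = begin
      ⟦ + m ℤ.* -[1+ n ] ⟧ℤ           ≡⟨ ≡.cong ⟦_⟧ℤ (≡.sym (ℤ.neg-distribʳ-* (+ m) (+ suc n))) ⟩
      ⟦ ℤ.- (+ m ℤ.* + suc n) ⟧ℤ      ≈⟨ -‿homo (+ m ℤ.* + suc n) ⟩
      - ⟦ + m ℤ.* + suc n ⟧ℤ          ≈⟨ -‿cong (*-homo⁺ m (+ suc n)) ⟩
      - (m · 1# * suc n · 1#)         ≈⟨ -‿distribʳ-* _ _ ⟩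
      m · 1# * - (suc n · 1#)         ∎

    *-homo : ∀ i j → ⟦ i ℤ.* j ⟧ℤ ≈ ⟦ i ⟧ℤ * ⟦ j ⟧ℤ
    *-homo (+ m) j = *-homo⁺ m j
    *-homo -[1+ m ] j = begin
      ⟦ -[1+ m ] ℤ.* j ⟧ℤ           ≡⟨ ≡.cong ⟦_⟧ℤ (≡.sym (ℤ.neg-distribˡ-* (+ suc m) j)) ⟩
      ⟦ ℤ.- (+ suc m ℤ.* j) ⟧ℤ      ≈⟨ -‿homo (+ suc m ℤ.* j) ⟩
      - ⟦ + suc m ℤ.* j ⟧ℤ          ≈⟨ -‿cong (*-homo⁺ (suc m) j) ⟩
      - (suc m · 1# * ⟦ j ⟧ℤ)       ≈⟨ -‿distribˡ-* _ _ ⟩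
      - (suc m · 1#) * ⟦ j ⟧ℤ       ∎

    ℤ⟶R : ℤ.+-*-rawRing -Raw-AlmostCommutative⟶ fromCommutativeRing R
    ℤ⟶R = record
      { ⟦_⟧ = ⟦_⟧ℤ ; +-homo = +-homo ; *-homo = *-homo ; -‿homo = -‿homo
      ; 0-homo = refl ; 1-homo = refl }

  open import Algebra.Solver.Ring ℤ.+-*-rawRing (fromCommutativeRing R) ℤ⟶R
    (λ i j → Maybe.map (λ i≡j → reflexive (≡.cong ⟦_⟧ℤ i≡j)) (dec⇒maybe (i ℤ.≟ j)))
    public using (solve; _:=_; _:+_; _:*_; _:-_; :-_; con)

-- Determinants: transposition, alternation, uniqueness and products.

module Determinants {c ℓ : Level} (R : CommutativeRing c ℓ) where
  open CommutativeRing R hiding (zero)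
  open IntegerCoefficients R
  open import Relation.Binary.Reasoning.Setoid setoid

  ∑ : ∀ {n} → (Fin n → Carrier) → Carrier
  ∑ {n} = sumF R n

  sgn : ℕ → Carrier
  sgn = pow R (- 1#)

  Matrix : ℕ → ℕ → Set c
  Matrix m n = Fin m → Fin n → Carrier

  Det : ∀ {n} → Matrix n n → Carrier
  Det {n} = det R n

  ∑-cong : ∀ {n} {f g : Fin n → Carrier} → (∀ i → f i ≈ g i) → ∑ f ≈ ∑ g
  ∑-cong {zero} eq = refl
  ∑-cong {suc n} eq = +-cong (eq zero) (∑-cong (eq ∘ suc))

  ∑-zero : ∀ {n} {f : Fin n → Carrier} → (∀ i → f i ≈ 0#) → ∑ f ≈ 0#
  ∑-zero {zero} eq = refl
  ∑-zero {suc n} eq = trans (+-cong (eq zero) (∑-zero (eq ∘ suc))) (+-identityˡ 0#)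

  ∑-linear : ∀ {n} (a : Carrier) (f g : Fin n → Carrier) →
             ∑ (λ i → a * f i + g i) ≈ a * ∑ f + ∑ g
  ∑-linear {zero} a f g = sym (trans (+-identityʳ _) (zeroʳ a))
  ∑-linear {suc n} a f g = trans (+-congˡ (∑-linear a (f ∘ suc) (g ∘ suc)))
    (solve 5 (λ a u v p q → (a :* u :+ v) :+ (a :* p :+ q) := a :* (u :+ p) :+ (v :+ q)) refl a _ _ _ _)

  ∑-+ : ∀ {n} (f g : Fin n → Carrier) → ∑ (λ i → f i + g i) ≈ ∑ f + ∑ g
  ∑-+ f g = trans (∑-cong (λ i → +-congʳ (sym (*-identityˡ (f i)))))
                  (trans (∑-linear 1# f g) (+-congʳ (*-identityˡ _)))

  *-distribˡ-∑ : ∀ {n} (a : Carrier) (f : Fin n → Carrier) → a * ∑ f ≈ ∑ (λ i → a * f i)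
  *-distribˡ-∑ {zero} a f = zeroʳ a
  *-distribˡ-∑ {suc n} a f = trans (distribˡ a _ _) (+-congˡ (*-distribˡ-∑ a (f ∘ suc)))

  ∑-swap : ∀ {m n} (f : Fin m → Fin n → Carrier) →
           ∑ (λ i → ∑ (λ j → f i j)) ≈ ∑ (λ j → ∑ (λ i → f i j))
  ∑-swap {zero} {n} f = sym (∑-zero {n} (λ _ → refl))
  ∑-swap {suc m} {n} f = trans (+-congˡ (∑-swap (f ∘ suc))) (sym (∑-+ {n} (f zero) _))

  ∑-split : ∀ m {n} (f : Fin (m ℕ.+ n) → Carrier) →
            ∑ f ≈ ∑ (λ i → f (i ↑ˡ n)) + ∑ (λ i → f (m ↑ʳ i))
  ∑-split zero f = sym (+-identityˡ _)
  ∑-split (suc m) f = trans (+-congˡ (∑-split m (f ∘ suc))) (sym (+-assoc _ _ _))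

  -- The arguments are naturals rather than elements of one `Fin n`, so that shifted diagonals such
  -- as `δ i (suc j)` can be written and indices of different types compared.
  δ : ℕ → ℕ → Carrier
  δ zero zero = 1#
  δ zero (suc n) = 0#
  δ (suc m) zero = 0#
  δ (suc m) (suc n) = δ m n

  δ-comm : ∀ m n → δ m n ≡ δ n m
  δ-comm zero zero = ≡.refl
  δ-comm zero (suc n) = ≡.refl
  δ-comm (suc m) zero = ≡.refl
  δ-comm (suc m) (suc n) = δ-comm m n

  δ-diag : ∀ m → δ m m ≡ 1#
  δ-diag zero = ≡.refl
  δ-diag (suc m) = δ-diag m

  δ-off : ∀ {m n} → m ≢ n → δ m n ≡ 0#
  δ-off {zero} {zero} m≢n = ⊥-elim (m≢n ≡.refl)
  δ-off {zero} {suc n} m≢n = ≡.refl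
  δ-off {suc m} {zero} m≢n = ≡.refl
  δ-off {suc m} {suc n} m≢n = δ-off (m≢n ∘ ≡.cong suc)

  𝟙 : ∀ {n} → Matrix n n
  𝟙 i j = δ (toℕ i) (toℕ j)

  ∑-𝟙 : ∀ {n} (f : Fin n → Carrier) (i : Fin n) → ∑ (λ k → f k * 𝟙 k i) ≈ f i
  ∑-𝟙 {suc n} f zero =
    trans (+-cong (*-identityʳ _) (∑-zero {n} (λ k → zeroʳ _))) (+-identityʳ _)
  ∑-𝟙 {suc n} f (suc i) = trans (+-cong (zeroʳ _) (∑-𝟙 (f ∘ suc) i)) (+-identityˡ _)

  _⊗_ : ∀ {l m n} → Matrix l m → Matrix m n → Matrix l n
  (A ⊗ B) i j = ∑ (λ k → A i k * B k j)

  _ᵀ : ∀ {m n} → Matrix m n → Matrix n m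
  (A ᵀ) i j = A j i

  infix 4 _≋_
  _≋_ : ∀ {m n} → Matrix m n → Matrix m n → Set ℓ
  A ≋ B = ∀ i j → A i j ≈ B i j

  minor : ∀ {n} → Matrix (suc n) (suc n) → Fin (suc n) → Matrix n n
  minor M j a b = M (suc a) (punchIn j b)

  det-cong : ∀ {n} {A B : Matrix n n} → A ≋ B → Det A ≈ Det B
  det-cong {zero} eq = refl
  det-cong {suc n} eq = ∑-cong (λ j → *-congˡ {sgn (toℕ j)}
    (*-cong (eq zero j) (det-cong (λ a b → eq (suc a) (punchIn j b)))))

  -- Expansion along the first row and then, in each minor, along the first column.
  doubleExpansion : ∀ {n} (M : Matrix (suc (suc n)) (suc (suc n))) → Carrier
  doubleExpansion {n} M = M zero zero * Det (minor M zero) -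
    ∑ (λ j → ∑ (λ i → (sgn (toℕ i) * sgn (toℕ j)) * ((M zero (suc j) * M (suc i) zero) *
      Det {n} (λ a b → M (suc (punchIn i a)) (suc (punchIn j b))))))

  -- Expanding a minor along its first column means transposing it, expanding along the first row,
  -- and transposing the smaller minors back. Hence transposition invariance is assumed at the two
  -- smaller sizes, to be supplied by induction.
  det≈doubleExpansion : ∀ {n} (M : Matrix (suc (suc n)) (suc (suc n))) →
    (∀ (A : Matrix (suc n) (suc n)) → Det A ≈ Det (A ᵀ)) →
    (∀ (A : Matrix n n) → Det A ≈ Det (A ᵀ)) →
    Det M ≈ doubleExpansion M
  det≈doubleExpansion {n} M ihₛ ih = begin
    Det M
      ≈⟨ +-cong (*-identityˡ _) (∑-cong column) ⟩
    M zero zero * Det (minor M zero) + ∑ (λ j → - 1# * S j)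
      ≈⟨ +-congˡ (sym (*-distribˡ-∑ (- 1#) S)) ⟩
    M zero zero * Det (minor M zero) + - 1# * ∑ S
      ≈⟨ solve 2 (λ u v → u :+ (:- con (+ 1)) :* v := u :- v) refl _ (∑ S) ⟩
    doubleExpansion M ∎
    where
    D : Fin (suc n) → Fin (suc n) → Carrier
    D i j = Det {n} (λ a b → M (suc (punchIn i a)) (suc (punchIn j b)))
    term : Fin (suc n) → Fin (suc n) → Carrier
    term j i = (sgn (toℕ i) * sgn (toℕ j)) * ((M zero (suc j) * M (suc i) zero) * D i j)
    S : Fin (suc n) → Carrier
    S j = ∑ (term j)
    column : ∀ j → (- 1# * sgn (toℕ j)) * (M zero (suc j) * Det (minor M (suc j))) ≈ - 1# * S j
    column j = begin
      (- 1# * sgn (toℕ j)) * (M zero (suc j) * Det (minor M (suc j)))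
        ≈⟨ *-congˡ (*-congˡ (ihₛ (minor M (suc j)))) ⟩
      (- 1# * sgn (toℕ j)) * (M zero (suc j) * ∑ E)
        ≈⟨ solve 3 (λ s m e → ((:- con (+ 1)) :* s) :* (m :* e) := (:- con (+ 1)) :* ((s :* m) :* e)) refl _ _ (∑ E) ⟩
      - 1# * ((sgn (toℕ j) * M zero (suc j)) * ∑ E)
        ≈⟨ *-congˡ (*-distribˡ-∑ _ E) ⟩
      - 1# * ∑ (λ i → (sgn (toℕ j) * M zero (suc j)) * E i)
        ≈⟨ *-congˡ (∑-cong (λ i → trans (*-congˡ (*-congˡ (*-congˡ (ih _))))
             (solve 5 (λ s m p q d → (s :* m) :* (p :* (q :* d)) := (p :* s) :* ((m :* q) :* d)) refl
               (sgn (toℕ j)) (M zero (suc j)) (sgn (toℕ i)) (M (suc i) zero) (D i j)))) ⟩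
      - 1# * S j ∎
      where
      E : Fin (suc n) → Carrier
      E i = sgn (toℕ i) * (M (suc i) zero * Det (minor (minor M (suc j) ᵀ) i))

  -- Transposing `M` exchanges the roles of i and j in the double sum and transposes every minor, so
  -- `doubleExpansion` is symmetric once the sums are swapped and the induction hypotheses applied.
  det-ᵀ : ∀ n (M : Matrix n n) → Det M ≈ Det (M ᵀ)
  det-ᵀ zero M = refl
  det-ᵀ (suc zero) M = refl
  det-ᵀ (suc (suc n)) M = begin
    Det M
      ≈⟨ det≈doubleExpansion M (det-ᵀ (suc n)) (det-ᵀ n) ⟩
    doubleExpansion M
      ≈⟨ +-cong (*-congˡ (det-ᵀ (suc n) (minor M zero)))
           (-‿cong (trans (∑-swap (λ j i → term M i j)) (∑-cong (λ i → ∑-cong (λ j →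
             *-cong (*-comm (sgn (toℕ i)) (sgn (toℕ j)))
               (*-cong (*-comm (M zero (suc j)) (M (suc i) zero))
                 (det-ᵀ n (λ a b → M (suc (punchIn i a)) (suc (punchIn j b)))))))))) ⟩
    doubleExpansion (M ᵀ)
      ≈⟨ sym (det≈doubleExpansion (M ᵀ) (det-ᵀ (suc n)) (det-ᵀ n)) ⟩
    Det (M ᵀ) ∎
    where
    term : Matrix (suc (suc n)) (suc (suc n)) → Fin (suc n) → Fin (suc n) → Carrier
    term M i j = (sgn (toℕ i) * sgn (toℕ j)) * ((M zero (suc j) * M (suc i) zero) *
      Det {n} (λ a b → M (suc (punchIn i a)) (suc (punchIn j b))))

  -- One law for a·A + B covers additivity and homogeneity. The matrices are rectangular because the
  -- induction for uniqueness freezes rows and pads columns; agreement is stated entry by entry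
  -- because functions are not compared by `≡`.
  record IsMultilinear {n N} (F : Matrix n N → Carrier) : Set (c Level.⊔ ℓ) where
    field
      cong : ∀ {A B} → A ≋ B → F A ≈ F B
      linear : ∀ i a {A B M} → (∀ j → M i j ≈ a * A i j + B i j) →
               (∀ k → k ≢ i → ∀ j → (M k j ≈ A k j) × (M k j ≈ B k j)) →
               F M ≈ a * F A + F B

  record IsAlternating {n N} (F : Matrix n N → Carrier) : Set (c Level.⊔ ℓ) where
    field
      isMultilinear : IsMultilinear F
      alternating : ∀ A {i k} → i Fin.< k → (∀ j → A i j ≈ A k j) → F A ≈ 0#
    open IsMultilinear isMultilinear public

  det-linear : ∀ {n} i a {A B M : Matrix n n} → (∀ j → M i j ≈ a * A i j + B i j) →
    (∀ k → k ≢ i → ∀ j → (M k j ≈ A k j) × (M k j ≈ B k j)) →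
    Det M ≈ a * Det A + Det B
  det-linear {suc n} zero a {A} {B} {M} row rest =
    trans (∑-cong (λ j → begin
      sgn (toℕ j) * (M zero j * Det (minor M j))
        ≈⟨ *-congˡ (*-congʳ (row j)) ⟩
      sgn (toℕ j) * ((a * A zero j + B zero j) * Det (minor M j))
        ≈⟨ solve 5 (λ s a u v d → s :* ((a :* u :+ v) :* d) := a :* (s :* (u :* d)) :+ s :* (v :* d)) refl _ _ _ _ _ ⟩
      a * (sgn (toℕ j) * (A zero j * Det (minor M j))) + sgn (toℕ j) * (B zero j * Det (minor M j))
        ≈⟨ +-cong (*-congˡ (*-congˡ (*-congˡ (det-cong (λ k b → proj₁ (rest (suc k) (λ ()) _))))))
                  (*-congˡ (*-congˡ (det-cong (λ k b → proj₂ (rest (suc k) (λ ()) _))))) ⟩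
      a * (sgn (toℕ j) * (A zero j * Det (minor A j))) + sgn (toℕ j) * (B zero j * Det (minor B j)) ∎))
    (∑-linear {suc n} a (λ j → sgn (toℕ j) * (A zero j * Det (minor A j)))
                        (λ j → sgn (toℕ j) * (B zero j * Det (minor B j))))
  det-linear {suc n} (suc i) a {A} {B} {M} row rest =
    trans (∑-cong (λ j → begin
      sgn (toℕ j) * (M zero j * Det (minor M j))
        ≈⟨ *-congˡ (*-congˡ (det-linear i a {minor A j} {minor B j} (λ b → row (punchIn j b))
             (λ k k≢i b → rest (suc k) (k≢i ∘ Fin.suc-injective) (punchIn j b)))) ⟩
      sgn (toℕ j) * (M zero j * (a * Det (minor A j) + Det (minor B j)))
        ≈⟨ solve 5 (λ s m a d e → s :* (m :* (a :* d :+ e)) := a :* (s :* (m :* d)) :+ s :* (m :* e)) refl _ _ _ _ _ ⟩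
      a * (sgn (toℕ j) * (M zero j * Det (minor A j))) + sgn (toℕ j) * (M zero j * Det (minor B j))
        ≈⟨ +-cong (*-congˡ (*-congˡ (*-congʳ (proj₁ (rest zero (λ ()) j)))))
                  (*-congˡ (*-congʳ (proj₂ (rest zero (λ ()) j)))) ⟩
      a * (sgn (toℕ j) * (A zero j * Det (minor A j))) + sgn (toℕ j) * (B zero j * Det (minor B j)) ∎))
    (∑-linear {suc n} a (λ j → sgn (toℕ j) * (A zero j * Det (minor A j)))
                        (λ j → sgn (toℕ j) * (B zero j * Det (minor B j))))

  det-isMultilinear : ∀ {n} → IsMultilinear (Det {n})
  det-isMultilinear = record { cong = det-cong ; linear = det-linear }

  -- In the expansion along the first column, the minors at rows 0 and 1 agree and the others have two equal rows.
  det-alternating₀₁ : ∀ {n} (A : Matrix (suc (suc n)) (suc (suc n))) →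
    (∀ j → A zero j ≈ A (suc zero) j) → Det A ≈ 0#
  minor-alternating₀₁ : ∀ {n} (A : Matrix (suc (suc n)) (suc (suc n))) (i : Fin n) →
    (∀ j → A zero j ≈ A (suc zero) j) → Det (minor (A ᵀ) (suc (suc i))) ≈ 0#

  det-alternating₀₁ {n} A eq = begin
    Det A ≈⟨ det-ᵀ _ A ⟩
    1# * (A zero zero * Det (minor (A ᵀ) zero)) +
      ((- 1# * 1#) * (A (suc zero) zero * Det (minor (A ᵀ) (suc zero))) + ∑ rest)
      ≈⟨ +-congˡ (+-cong (*-congˡ (*-cong (sym (eq zero)) (det-cong minors≋))) (∑-zero rest≈0)) ⟩
    1# * (A zero zero * Det (minor (A ᵀ) zero)) +
      ((- 1# * 1#) * (A zero zero * Det (minor (A ᵀ) zero)) + 0#)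
      ≈⟨ solve 1 (λ u → con (+ 1) :* u :+ (((:- con (+ 1)) :* con (+ 1)) :* u :+ con (+ 0)) := con (+ 0)) refl
           (A zero zero * Det (minor (A ᵀ) zero)) ⟩
    0# ∎
    where
    rest : Fin n → Carrier
    rest i = sgn (suc (suc (toℕ i))) * (A (suc (suc i)) zero * Det (minor (A ᵀ) (suc (suc i))))
    minors≋ : minor (A ᵀ) (suc zero) ≋ minor (A ᵀ) zero
    minors≋ a zero = eq (suc a)
    minors≋ a (suc b) = refl
    rest≈0 : ∀ i → rest i ≈ 0#
    rest≈0 i = trans (*-congˡ (trans (*-congˡ (minor-alternating₀₁ A i eq)) (zeroʳ _))) (zeroʳ _)

  minor-alternating₀₁ {suc n} A i eq =
    trans (det-ᵀ _ (minor (A ᵀ) (suc (suc i)))) (det-alternating₀₁ (minor (A ᵀ) (suc (suc i)) ᵀ) (eq ∘ suc))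

  infixr 5 _◂_
  _◂_ : ∀ {n N} → (Fin N → Carrier) → Matrix n N → Matrix (suc n) N
  (u ◂ A) zero = u
  (u ◂ A) (suc i) = A i

  ◂-η : ∀ {n N} (A : Matrix (suc n) N) → A ≋ A zero ◂ (A ∘ suc)
  ◂-η A zero j = refl
  ◂-η A (suc i) j = refl

  ◂-cong : ∀ {n N} {u v : Fin N → Carrier} {A B : Matrix n N} →
           (∀ j → u j ≈ v j) → A ≋ B → u ◂ A ≋ v ◂ B
  ◂-cong eq eqs zero j = eq j
  ◂-cong eq eqs (suc i) j = eqs i j

  -- Expand F (u + v , u + v , A) = 0.
  swap₀₁ : ∀ {n N} {F : Matrix (suc (suc n)) N → Carrier} → IsMultilinear F →
    (∀ A → (∀ j → A zero j ≈ A (suc zero) j) → F A ≈ 0#) →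
    ∀ u v A → F (u ◂ v ◂ A) ≈ - F (v ◂ u ◂ A)
  swap₀₁ {N = N} {F} multilinear alternating u v A = begin
    F (u ◂ v ◂ A)
      ≈⟨ solve 2 (λ p q → p := (con (+ 1) :* p :+ q) :- q) refl _ (F (v ◂ u ◂ A)) ⟩
    (1# * F (u ◂ v ◂ A) + F (v ◂ u ◂ A)) - F (v ◂ u ◂ A)
      ≈⟨ +-congʳ (+-cong (*-congˡ (sym half)) (sym half′)) ⟩
    (1# * F (u ◂ w ◂ A) + F (v ◂ w ◂ A)) - F (v ◂ u ◂ A)
      ≈⟨ +-congʳ (sym (linear zero 1# (λ j → +-congʳ (sym (*-identityˡ (u j))))
           (λ { zero k≢i → ⊥-elim (k≢i ≡.refl) ; (suc k) _ j → refl , refl }))) ⟩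
    F (w ◂ w ◂ A) - F (v ◂ u ◂ A)
      ≈⟨ +-congʳ (alternating _ (λ _ → refl)) ⟩
    0# - F (v ◂ u ◂ A)
      ≈⟨ +-identityˡ _ ⟩
    - F (v ◂ u ◂ A) ∎
    where
    open IsMultilinear multilinear
    w : Fin N → Carrier
    w j = u j + v j
    expand : ∀ x → F (x ◂ w ◂ A) ≈ 1# * F (x ◂ u ◂ A) + F (x ◂ v ◂ A)
    expand x = linear (suc zero) 1# (λ j → +-congʳ (sym (*-identityˡ (u j))))
      (λ { zero _ j → refl , refl ; (suc zero) k≢i → ⊥-elim (k≢i ≡.refl) ; (suc (suc k)) _ j → refl , refl })
    half : F (u ◂ w ◂ A) ≈ F (u ◂ v ◂ A)
    half = trans (expand u) (trans (+-congʳ (trans (*-congˡ (alternating _ (λ _ → refl))) (zeroʳ 1#))) (+-identityˡ _))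
    half′ : F (v ◂ w ◂ A) ≈ F (v ◂ u ◂ A)
    half′ = trans (expand v) (trans (+-cong (*-identityˡ _) (alternating _ (λ _ → refl))) (+-identityʳ _))

  -- If the equal rows are 0 and k ≥ 2, interchanging rows 0 and 1 puts them at 1 and k. Two equal
  -- rows below the top remain equal in every minor of the expansion along the first row.
  det-alternating : ∀ {n} (A : Matrix n n) {i k} → i Fin.< k → (∀ j → A i j ≈ A k j) → Det A ≈ 0#
  det-alternating-suc : ∀ {n} (A : Matrix (suc n) (suc n)) {i k : Fin n} → i Fin.< k →
    (∀ j → A (suc i) j ≈ A (suc k) j) → Det A ≈ 0#

  det-alternating {suc (suc n)} A {zero} {suc zero} i<k eq = det-alternating₀₁ A eq
  det-alternating {suc (suc n)} A {zero} {suc (suc k)} i<k eq = begin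
    Det A
      ≈⟨ det-cong {A = A} {A zero ◂ A (suc zero) ◂ rows} (λ { zero j → refl ; (suc zero) j →
          refl ; (suc (suc i)) j → refl }) ⟩
    Det (A zero ◂ A (suc zero) ◂ rows)
      ≈⟨ swap₀₁ det-isMultilinear det-alternating₀₁ (A zero) (A (suc zero)) rows ⟩
    - Det (A (suc zero) ◂ A zero ◂ rows)
      ≈⟨ -‿cong (det-alternating-suc (A (suc zero) ◂ A zero ◂ rows) {zero} {suc k} (s≤s z≤n) eq) ⟩
    - 0#
      ≈⟨ solve 0 (:- con (+ 0) := con (+ 0)) refl ⟩
    0# ∎
    where
    rows : Matrix n (suc (suc n))
    rows i = A (suc (suc i))
  det-alternating {suc n} A {suc i} {suc k} (s≤s i<k) eq = det-alternating-suc A i<k eq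

  det-alternating-suc {n} A i<k eq = ∑-zero {suc n} (λ j → trans
    (*-congˡ {sgn (toℕ j)} (trans (*-congˡ (det-alternating (minor A j) i<k (eq ∘ punchIn j))) (zeroʳ (A zero j))))
    (zeroʳ _))

  ◂-isAlternating : ∀ {n N} {F : Matrix (suc n) N → Carrier} → IsAlternating F →
    ∀ u → IsAlternating (λ A → F (u ◂ A))
  ◂-isAlternating alt u = record
    { isMultilinear = record
      { cong = λ eq → cong (◂-cong (λ _ → refl) eq)
      ; linear = λ i a row rest → linear (suc i) a row
          (λ { zero _ j → refl , refl ; (suc k) k≢i → rest k (k≢i ∘ ≡.cong suc) })
      }
    ; alternating = λ A i<k eq → alternating (u ◂ A) (s≤s i<k) eq
    }
    where open IsAlternating alt

  -- Row j passes the j rows above it by adjacent interchanges, each costing a sign. The recursion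
  -- freezes row 0 at the top, lifts the row to just below it, and performs one last interchange.
  row-to-top : ∀ {n N} {F : Matrix (suc n) N → Carrier} → IsAlternating F →
    ∀ (r : Matrix (suc n) N) j → F (r j ◂ (r ∘ punchIn j)) ≈ sgn (toℕ j) * F r
  row-to-top {F = F} alt r zero =
    trans (IsAlternating.cong alt (λ i j → sym (◂-η r i j))) (sym (*-identityˡ _))
  row-to-top {suc n} {F = F} alt r (suc j) = begin
    F (r (suc j) ◂ (r ∘ punchIn (suc j)))
      ≈⟨ cong (λ { zero _ → refl ; (suc zero) _ → refl ; (suc (suc i)) _ → refl }) ⟩
    F (r (suc j) ◂ r zero ◂ (r ∘ suc ∘ punchIn j))
      ≈⟨ swap₀₁ isMultilinear (λ A → alternating A {zero} {suc zero} (s≤s z≤n)) _ _ _ ⟩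
    - F (r zero ◂ r (suc j) ◂ (r ∘ suc ∘ punchIn j))
      ≈⟨ -‿cong (row-to-top (◂-isAlternating alt (r zero)) (r ∘ suc) j) ⟩
    - (sgn (toℕ j) * F (r zero ◂ (r ∘ suc)))
      ≈⟨ -‿cong (*-congˡ (cong (λ i k → sym (◂-η r i k)))) ⟩
    - (sgn (toℕ j) * F r)
      ≈⟨ solve 2 (λ s f → :- (s :* f) := ((:- con (+ 1)) :* s) :* f) refl _ _ ⟩
    sgn (suc (toℕ j)) * F r ∎
    where open IsAlternating alt

  linear-∑ : ∀ {n N} {F : Matrix (suc n) N → Carrier} → IsMultilinear F →
    ∀ {K} (a : Fin K → Carrier) (u : Matrix K N) A →
    F ((λ j → ∑ (λ k → a k * u k j)) ◂ A) ≈ ∑ (λ k → a k * F (u k ◂ A))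
  linear-∑ {F = F} multilinear {zero} a u A = begin
    F ((λ _ → 0#) ◂ A)
      -- Writing the zero row as (-1)·0 + 0 turns the single linearity law into F = -F + F, hence F
      -- = 0.
      ≈⟨ linear zero (- 1#) (λ j → solve 0 (con (+ 0) := (:- con (+ 1)) :* con (+ 0) :+ con (+ 0)) refl)
           (λ { zero k≢i → ⊥-elim (k≢i ≡.refl) ; (suc k) _ j → refl , refl }) ⟩
    - 1# * F ((λ _ → 0#) ◂ A) + F ((λ _ → 0#) ◂ A)
      ≈⟨ solve 1 (λ x → (:- con (+ 1)) :* x :+ x := con (+ 0)) refl _ ⟩
    0# ∎
    where open IsMultilinear multilinear
  linear-∑ {F = F} multilinear {suc K} a u A = trans
    (linear zero (a zero) (λ j → refl)
      (λ { zero k≢i → ⊥-elim (k≢i ≡.refl) ; (suc k) _ j → refl , refl }))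
    (+-congˡ (linear-∑ multilinear (a ∘ suc) (u ∘ suc) A))
    where open IsMultilinear multilinear

  -- An invariance under changing one row is extended to all rows by treating the top row and
  -- freezing its new value. Below it serves to clear a whole column at once.
  rowwise : ∀ {s} {n N} (F : Matrix n N → Carrier) (S : (u v : Fin N → Carrier) → Set s) →
    (∀ {A B} → A ≋ B → F A ≈ F B) →
    (∀ i {A B} → S (A i) (B i) → (∀ k → k ≢ i → ∀ j → A k j ≈ B k j) → F A ≈ F B) →
    ∀ {A B} → (∀ i → S (A i) (B i)) → F A ≈ F B
  rowwise {n = zero} F S F-cong step rel = F-cong (λ ())
  rowwise {n = suc n} F S F-cong step {A} {B} rel = begin
    F A
      ≈⟨ F-cong (◂-η A) ⟩
    F (A zero ◂ (A ∘ suc))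
      ≈⟨ step zero (rel zero) (λ { zero k≢i → ⊥-elim (k≢i ≡.refl) ; (suc k) _ j → refl }) ⟩
    F (B zero ◂ (A ∘ suc))
      ≈⟨ rowwise (λ X → F (B zero ◂ X)) S (λ eq → F-cong (◂-cong (λ _ → refl) eq))
           (λ i s rest → step (suc i) s (λ { zero _ j → refl ; (suc k) k≢i → rest k (k≢i ∘ ≡.cong suc) }))
           (rel ∘ suc) ⟩
    F (B zero ◂ (B ∘ suc))
      ≈⟨ F-cong (λ i j → sym (◂-η B i j)) ⟩
    F B ∎

  -- Composing with this insertion of a zero coordinate makes a function of rows of length n + 1
  -- into one of rows of length n, to which the induction for uniqueness applies.
  pad : ∀ {n} → Fin (suc n) → (Fin n → Carrier) → Fin (suc n) → Carrier
  pad k u = insertAt u k 0#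

  pad-cong : ∀ {n} (k : Fin (suc n)) {u v : Fin n → Carrier} → (∀ j → u j ≈ v j) → ∀ j → pad k u j ≈ pad k v j
  pad-cong zero eq zero = refl
  pad-cong zero eq (suc j) = eq j
  pad-cong {suc n} (suc k) eq zero = eq zero
  pad-cong {suc n} (suc k) eq (suc j) = pad-cong k (eq ∘ suc) j

  pad-linear : ∀ {n} (k : Fin (suc n)) a {w u v : Fin n → Carrier} → (∀ j → w j ≈ a * u j + v j) →
    ∀ j → pad k w j ≈ a * pad k u j + pad k v j
  pad-linear zero a eq zero = solve 1 (λ a → con (+ 0) := a :* con (+ 0) :+ con (+ 0)) refl a
  pad-linear zero a eq (suc j) = eq j
  pad-linear {suc n} (suc k) a eq zero = eq zero
  pad-linear {suc n} (suc k) a eq (suc j) = pad-linear k a (eq ∘ suc) j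

  pad-decompose : ∀ {n} (k : Fin (suc n)) (u : Fin (suc n) → Carrier) j →
    u j ≈ u k * 𝟙 k j + pad k (u ∘ punchIn k) j
  pad-decompose zero u zero = solve 1 (λ x → x := x :* con (+ 1) :+ con (+ 0)) refl (u zero)
  pad-decompose zero u (suc j) = solve 2 (λ x y → x := y :* con (+ 0) :+ x) refl (u (suc j)) (u zero)
  pad-decompose {suc n} (suc k) u zero = solve 2 (λ x y → x := y :* con (+ 0) :+ x) refl (u zero) (u (suc k))
  pad-decompose {suc n} (suc k) u (suc j) = pad-decompose k (u ∘ suc) j

  pad-𝟙 : ∀ {n} (k : Fin (suc n)) (i : Fin n) j → pad k (𝟙 i) j ≈ 𝟙 (punchIn k i) j
  pad-𝟙 zero i zero = refl
  pad-𝟙 zero i (suc j) = refl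
  pad-𝟙 {suc n} (suc k) zero zero = refl
  pad-𝟙 {suc n} (suc k) zero (suc j) = pad-0 k j
    where
    pad-0 : ∀ {n} (k : Fin (suc n)) j → pad k (λ _ → 0#) j ≈ 0#
    pad-0 zero zero = refl
    pad-0 zero (suc j) = refl
    pad-0 {suc n} (suc k) zero = refl
    pad-0 {suc n} (suc k) (suc j) = pad-0 k j
  pad-𝟙 {suc n} (suc k) (suc i) zero = refl
  pad-𝟙 {suc n} (suc k) (suc i) (suc j) = pad-𝟙 k i j

  pad-isAlternating : ∀ {n m} {F : Matrix m (suc n) → Carrier} → IsAlternating F →
    ∀ k → IsAlternating (λ (A : Matrix m n) → F (λ i → pad k (A i)))
  pad-isAlternating alt k = record
    { isMultilinear = record
      { cong = λ eq → cong (λ i → pad-cong k (eq i))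
      ; linear = λ i a row rest → linear i a (pad-linear k a row)
          (λ l l≢i j → pad-cong k (λ j → proj₁ (rest l l≢i j)) j , pad-cong k (λ j → proj₂ (rest l l≢i j)) j)
      }
    ; alternating = λ A i<k eq → alternating _ i<k (pad-cong k eq)
    }
    where open IsAlternating alt

  -- Expand the top row in unit vectors. With `𝟙 k` on top, multiples of it can be removed from the
  -- other rows, which clears column k; what remains is an alternating function of the minor at k,
  -- known by induction up to its value at the identity. That value is `sgn k * F 𝟙`, since row k of
  -- the identity has been moved to the top.
  alternating-unique : ∀ {n} {F : Matrix n n → Carrier} → IsAlternating F → ∀ M → F M ≈ Det M * F 𝟙
  alternating-unique {zero} alt M = trans (IsAlternating.cong alt (λ ())) (sym (*-identityˡ _))
  alternating-unique {suc n} {F} alt M = begin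
    F M
      ≈⟨ cong (λ i j → trans (◂-η M i j) (◂-cong (λ j → sym (∑-𝟙 (M zero) j)) (λ _ _ → refl) i j)) ⟩
    F ((λ j → ∑ (λ k → M zero k * 𝟙 k j)) ◂ (M ∘ suc))
      ≈⟨ linear-∑ isMultilinear (M zero) 𝟙 (M ∘ suc) ⟩
    ∑ (λ k → M zero k * F (𝟙 k ◂ (M ∘ suc)))
      ≈⟨ ∑-cong (λ k → trans (*-congˡ (cofactor k))
           (solve 4 (λ m d s f → m :* (d :* (s :* f)) := f :* (s :* (m :* d)))
               refl (M zero k) (Det (minor M k)) (sgn (toℕ k)) (F 𝟙))) ⟩
    ∑ (λ k → F 𝟙 * (sgn (toℕ k) * (M zero k * Det (minor M k))))
      ≈⟨ sym (*-distribˡ-∑ (F 𝟙) (λ k → sgn (toℕ k) * (M zero k * Det (minor M k)))) ⟩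
    F 𝟙 * Det M
      ≈⟨ *-comm _ _ ⟩
    Det M * F 𝟙 ∎
    where
    open IsAlternating alt
    _∼[_]_ : (u : Fin (suc n) → Carrier) → Fin (suc n) → (v : Fin (suc n) → Carrier) → Set (c Level.⊔ ℓ)
    u ∼[ k ] v = ∃ λ a → ∀ j → u j ≈ a * 𝟙 k j + v j
    clear : ∀ k i {A B : Matrix n (suc n)} → A i ∼[ k ] B i → (∀ l → l ≢ i → ∀ j → A l j ≈ B l j) →
            F (𝟙 k ◂ A) ≈ F (𝟙 k ◂ B)
    clear k i {A} {B} (a , eq) rest = begin
      F (𝟙 k ◂ A)
        ≈⟨ linear (suc i) a {𝟙 k ◂ A′} {𝟙 k ◂ B}
             (λ j → trans (eq j) (+-congʳ (*-congˡ (reflexive (≡.cong (λ r → r j) (≡.sym A′i))))))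
             (λ { zero _ j → refl , refl
                ; (suc l) l≢i j → reflexive (≡.cong
                    (λ r → r j) (≡.sym (A′l l (l≢i ∘ ≡.cong suc)))) , rest l (l≢i ∘ ≡.cong suc) j }) ⟩
      a * F (𝟙 k ◂ A′) + F (𝟙 k ◂ B)
        ≈⟨ +-congʳ (*-congˡ (alternating (𝟙 k ◂ A′) {zero} {suc i} (s≤s z≤n)
             (λ j → reflexive (≡.cong (λ r → r j) (≡.sym A′i))))) ⟩
      a * 0# + F (𝟙 k ◂ B)
        ≈⟨ trans (+-congʳ (zeroʳ a)) (+-identityˡ _) ⟩
      F (𝟙 k ◂ B) ∎
      where
      A′ : Matrix n (suc n)
      A′ = updateAt A i (λ _ → 𝟙 k)
      A′i : A′ i ≡ 𝟙 k
      A′i = updateAt-updates i A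
      A′l : ∀ l → l ≢ i → A′ l ≡ A l
      A′l l l≢i = updateAt-minimal l i A l≢i
    cofactor : ∀ k → F (𝟙 k ◂ (M ∘ suc)) ≈ Det (minor M k) * (sgn (toℕ k) * F 𝟙)
    cofactor k = begin
      F (𝟙 k ◂ (M ∘ suc))
        ≈⟨ rowwise (λ A → F (𝟙 k ◂ A)) _∼[ k ]_ (λ eq → cong (◂-cong (λ _ → refl) eq)) (clear k)
             (λ i → M (suc i) k , pad-decompose k (M (suc i))) ⟩
      F (𝟙 k ◂ λ i → pad k (minor M k i))
        ≈⟨ alternating-unique (pad-isAlternating (◂-isAlternating alt (𝟙 k)) k) (minor M k) ⟩
      Det (minor M k) * F (𝟙 k ◂ λ i → pad k (𝟙 i))
        ≈⟨ *-congˡ (cong (◂-cong (λ _ → refl) (pad-𝟙 k))) ⟩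
      Det (minor M k) * F (𝟙 k ◂ (𝟙 ∘ punchIn k))
        ≈⟨ *-congˡ (row-to-top alt 𝟙 k) ⟩
      Det (minor M k) * (sgn (toℕ k) * F 𝟙) ∎

  ⊗-identityˡ : ∀ {m n} (A : Matrix m n) → 𝟙 ⊗ A ≋ A
  ⊗-identityˡ {m} A i j = trans
    (∑-cong {m} (λ k → trans (*-comm _ (A k j)) (*-congˡ (reflexive (δ-comm (toℕ i) (toℕ k))))))
    (∑-𝟙 (λ k → A k j) i)

  -- As a function of the rows of the left factor, the determinant of the product is alternating,
  -- and at the identity it equals `Det B`; uniqueness gives the rest.
  det-⊗ : ∀ {n} (A B : Matrix n n) → Det (A ⊗ B) ≈ Det A * Det B
  det-⊗ {n} A B = trans (alternating-unique alt A) (*-congˡ (det-cong (⊗-identityˡ B)))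
    where
    ⊗-row : ∀ i a {M X Y : Matrix n n} → (∀ j → M i j ≈ a * X i j + Y i j) →
            ∀ j → (M ⊗ B) i j ≈ a * (X ⊗ B) i j + (Y ⊗ B) i j
    ⊗-row i a {M} {X} {Y} eq j = trans
      (∑-cong (λ k → trans (*-congʳ (eq k))
        (solve 4 (λ a x y b → (a :* x :+ y) :* b := a :* (x :* b) :+ y :* b) refl a (X i k) (Y i k) (B k j))))
      (∑-linear a (λ k → X i k * B k j) (λ k → Y i k * B k j))
    alt : IsAlternating (λ (M : Matrix n n) → Det (M ⊗ B))
    alt = record
      { isMultilinear = record
        { cong = λ eq → det-cong (λ i j → ∑-cong (λ k → *-congʳ (eq i k)))
        ; linear = λ i a {X} {Y} {M} row rest → det-linear i a {X ⊗ B} {Y ⊗ B} {M ⊗ B} (⊗-row i a {M} {X} {Y} row)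
            (λ k k≢i j → ∑-cong (λ l → *-congʳ (proj₁ (rest k k≢i l))) , ∑-cong (λ l → *-congʳ (proj₂ (rest k k≢i l))))
        }
      ; alternating = λ M i<k eq → det-alternating (M ⊗ B) i<k (λ j → ∑-cong (λ l → *-congʳ (eq l)))
      }

  -- Triangular, block triangular and rescaled matrices.

  det-lowerRow : ∀ {n} (M : Matrix (suc n) (suc n)) → (∀ j → M zero (suc j) ≈ 0#) →
    Det M ≈ M zero zero * Det (minor M zero)
  det-lowerRow {n} M eq = trans
    (+-cong (*-identityˡ _) (∑-zero {n} (λ j →
      trans (*-congˡ (trans (*-congʳ (eq j)) (zeroˡ _))) (zeroʳ _))))
    (+-identityʳ _)

  det-𝟙 : ∀ n → Det {n} 𝟙 ≈ 1#
  det-𝟙 zero = refl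
  det-𝟙 (suc n) = trans (det-lowerRow {n} 𝟙 (λ _ → refl)) (trans (*-identityˡ _) (det-𝟙 n))

  punchIn-↑ˡ : ∀ {m} n (j : Fin (suc m)) (b : Fin m) → punchIn (j ↑ˡ n) (b ↑ˡ n) ≡ punchIn j b ↑ˡ n
  punchIn-↑ˡ n zero b = ≡.refl
  punchIn-↑ˡ n (suc j) zero = ≡.refl
  punchIn-↑ˡ n (suc j) (suc b) = ≡.cong suc (punchIn-↑ˡ n j b)

  punchIn-↑ʳ : ∀ m {n} (j : Fin (suc m)) (b : Fin n) → punchIn (j ↑ˡ n) (m ↑ʳ b) ≡ suc m ↑ʳ b
  punchIn-↑ʳ m zero b = ≡.refl
  punchIn-↑ʳ (suc m) (suc j) b = ≡.cong suc (punchIn-↑ʳ m j b)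

  -- In the expansion along the first row, the right-hand columns contribute nothing, and the minors
  -- at the left-hand columns are again block triangular with the same `Y`.
  det-blockLower : ∀ m {n} (X : Matrix m m) (Y : Matrix n n) (M : Matrix (m ℕ.+ n) (m ℕ.+ n)) →
    (∀ i j → M (i ↑ˡ n) (j ↑ˡ n) ≈ X i j) →
    (∀ i j → M (i ↑ˡ n) (m ↑ʳ j) ≈ 0#) →
    (∀ i j → M (m ↑ʳ i) (m ↑ʳ j) ≈ Y i j) →
    Det M ≈ Det X * Det Y
  det-blockLower zero X Y M ul ur lr = trans (det-cong lr) (sym (*-identityˡ _))
  det-blockLower (suc m) {n} X Y M ul ur lr = begin
    Det M
      ≈⟨ ∑-split (suc m) term ⟩
    ∑ (λ j → term (j ↑ˡ n)) + ∑ (λ j → term (suc m ↑ʳ j))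
      ≈⟨ +-cong (∑-cong left) (∑-zero right) ⟩
    ∑ (λ j → Det Y * (sgn (toℕ j) * (X zero j * Det (minor X j)))) + 0#
      ≈⟨ +-identityʳ _ ⟩
    ∑ (λ j → Det Y * (sgn (toℕ j) * (X zero j * Det (minor X j))))
      ≈⟨ sym (*-distribˡ-∑ (Det Y) (λ j → sgn (toℕ j) * (X zero j * Det (minor X j)))) ⟩
    Det Y * Det X
      ≈⟨ *-comm _ _ ⟩
    Det X * Det Y ∎
    where
    term : Fin (suc m ℕ.+ n) → Carrier
    term j = sgn (toℕ j) * (M zero j * Det (minor M j))
    right : ∀ j → term (suc m ↑ʳ j) ≈ 0#
    right j = trans (*-congˡ (trans (*-congʳ (ur zero j)) (zeroˡ _))) (zeroʳ _)
    left : ∀ j → term (j ↑ˡ n) ≈ Det Y * (sgn (toℕ j) * (X zero j * Det (minor X j)))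
    left j = trans
      (*-cong (reflexive (≡.cong sgn (Fin.toℕ-↑ˡ j n))) (*-cong (ul zero j)
        (det-blockLower m (minor X j) Y (minor M (j ↑ˡ n))
          (λ a b → trans (reflexive (≡.cong (M (suc a ↑ˡ n)) (punchIn-↑ˡ n j b))) (ul (suc a) (punchIn j b)))
          (λ a b → trans (reflexive (≡.cong (M (suc a ↑ˡ n)) (punchIn-↑ʳ m j b))) (ur (suc a) b))
          (λ a b → trans (reflexive (≡.cong (M (suc m ↑ʳ a)) (punchIn-↑ʳ m j b))) (lr a b)))))
      (solve 4 (λ s x d y → s :* (x :* (d :* y)) := y :* (s :* (x :* d)))
          refl (sgn (toℕ j)) (X zero j) (Det (minor X j)) (Det Y))

  det-blockUpper : ∀ m {n} (X : Matrix m m) (Y : Matrix n n) (M : Matrix (m ℕ.+ n) (m ℕ.+ n)) →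
    (∀ i j → M (i ↑ˡ n) (j ↑ˡ n) ≈ X i j) →
    (∀ i j → M (m ↑ʳ i) (j ↑ˡ n) ≈ 0#) →
    (∀ i j → M (m ↑ʳ i) (m ↑ʳ j) ≈ Y i j) →
    Det M ≈ Det X * Det Y
  det-blockUpper m X Y M ul ll lr = begin
    Det M                  ≈⟨ det-ᵀ _ M ⟩
    Det (M ᵀ)              ≈⟨ det-blockLower m (X ᵀ) (Y ᵀ) (M ᵀ) (λ i j → ul j i) (λ i j → ll j i) (λ i j → lr j i) ⟩
    Det (X ᵀ) * Det (Y ᵀ)  ≈⟨ *-cong (sym (det-ᵀ _ X)) (sym (det-ᵀ _ Y)) ⟩
    Det X * Det Y          ∎

  ∏ : ∀ {n} → (Fin n → Carrier) → Carrier
  ∏ {zero} d = 1#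
  ∏ {suc n} d = d zero * ∏ (d ∘ suc)

  ∏-* : ∀ {n} (d e : Fin n → Carrier) → ∏ (λ i → d i * e i) ≈ ∏ d * ∏ e
  ∏-* {zero} d e = sym (*-identityˡ 1#)
  ∏-* {suc n} d e = trans (*-congˡ (∏-* (d ∘ suc) (e ∘ suc)))
    (solve 4 (λ a b p q → (a :* b) :* (p :* q) := (a :* p) :* (b :* q)) refl _ _ _ _)

  det-scaleRows : ∀ {n} (d : Fin n → Carrier) (M : Matrix n n) → Det (λ i j → d i * M i j) ≈ ∏ d * Det M
  det-scaleRows {zero} d M = sym (*-identityˡ 1#)
  det-scaleRows {suc n} d M = begin
    Det (λ i j → d i * M i j)
      ≈⟨ ∑-cong (λ j → trans (*-congˡ {sgn (toℕ j)} (*-congˡ (det-scaleRows (d ∘ suc) (minor M j))))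
           (solve 5 (λ s d m p e → s :* ((d :* m) :* (p :* e)) := (d :* p) :* (s :* (m :* e))) refl
             (sgn (toℕ j)) (d zero) (M zero j) (∏ (d ∘ suc)) (Det (minor M j)))) ⟩
    ∑ (λ j → ∏ d * (sgn (toℕ j) * (M zero j * Det (minor M j))))
      ≈⟨ sym (*-distribˡ-∑ (∏ d) (λ j → sgn (toℕ j) * (M zero j * Det (minor M j)))) ⟩
    ∏ d * Det M ∎

  det-scaleColumns : ∀ {n} (d : Fin n → Carrier) (M : Matrix n n) → Det (λ i j → M i j * d j) ≈ ∏ d * Det M
  det-scaleColumns d M = begin
    Det (λ i j → M i j * d j)   ≈⟨ det-ᵀ _ (λ i j → M i j * d j) ⟩
    Det (λ i j → M j i * d i)   ≈⟨ det-cong (λ i j → *-comm (M j i) (d i)) ⟩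
    Det (λ i j → d i * M j i)   ≈⟨ det-scaleRows d (M ᵀ) ⟩
    ∏ d * Det (M ᵀ)             ≈⟨ *-congˡ (sym (det-ᵀ _ M)) ⟩
    ∏ d * Det M                 ∎

-- Complete homogeneous polynomials and the linear recurrence they satisfy.

module Recurrences {c ℓ : Level} (R : CommutativeRing c ℓ) where
  open CommutativeRing R hiding (zero)
  open IntegerCoefficients R
  open Determinants R
  open import Relation.Binary.Reasoning.Setoid setoid
  open import Data.List.Relation.Binary.Permutation.Setoid setoid as ↭ using (_↭_; ↭-refl; ↭-trans; ↭-prep)
  open import Data.List.Relation.Binary.Permutation.Setoid.Properties setoid using (↭-shift)

  sgn-even : ∀ m → sgn (m ℕ.+ m) ≈ 1#
  sgn-even zero = refl
  sgn-even (suc m) = begin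
    - 1# * sgn (m ℕ.+ suc m)        ≡⟨ ≡.cong (λ k → - 1# * sgn k) (ℕ.+-suc m m) ⟩
    - 1# * (- 1# * sgn (m ℕ.+ m))   ≈⟨ solve 1 (λ s → (:- con (+ 1)) :* ((:- con (+ 1)) :* s) := s) refl _ ⟩
    sgn (m ℕ.+ m)                   ≈⟨ sgn-even m ⟩
    1#                              ∎

  -- Separate the monomials without z from those divisible by z. Allowing every integer k, in
  -- particular -1, lets the later recurrences run over ℤ without case distinctions.
  h-step : ∀ z zs k → h R (ℤ.suc k) (z ∷ zs) ≈ h R (ℤ.suc k) zs + z * h R k (z ∷ zs)
  h-step z zs (+ k) = +-cong (*-identityˡ _) (begin
    sumF R (suc k) (λ j → (z * pow R z (toℕ j)) * hℕ R (k ℕ.∸ toℕ j) zs)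
      ≈⟨ ∑-cong {suc k} (λ j → *-assoc z (pow R z (toℕ j)) (hℕ R (k ℕ.∸ toℕ j) zs)) ⟩
    sumF R (suc k) (λ j → z * (pow R z (toℕ j) * hℕ R (k ℕ.∸ toℕ j) zs))
      ≈⟨ sym (*-distribˡ-∑ {suc k} z (λ j → pow R z (toℕ j) * hℕ R (k ℕ.∸ toℕ j) zs)) ⟩
    z * sumF R (suc k) (λ j → pow R z (toℕ j) * hℕ R (k ℕ.∸ toℕ j) zs)
      ≈⟨ *-congˡ (fold k) ⟩
    z * hℕ R k (z ∷ zs) ∎)
    where
    -- The clauses of `hℕ` split on the degree before the list, so the sum folds back only after a
    -- case split on `k`.
    fold : ∀ k → sumF R (suc k) (λ j → pow R z (toℕ j) * hℕ R (k ℕ.∸ toℕ j) zs) ≈ hℕ R k (z ∷ zs)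
    fold zero = refl
    fold (suc k) = refl
  h-step z zs -[1+ zero ] = +-cong (*-identityˡ _) (sym (zeroʳ z))
  h-step z zs -[1+ suc k ] = sym (trans (+-identityˡ _) (zeroʳ z))

  h-∷-cong : ∀ {y z ys zs} → y ≈ z → (∀ k → h R k ys ≈ h R k zs) → ∀ k → h R k (y ∷ ys) ≈ h R k (z ∷ zs)
  h-∷-cong y≈z eq -[1+ k ] = refl
  h-∷-cong {y} {z} {ys} {zs} y≈z eq (+ zero) =
    trans (h-step y ys -[1+ 0 ]) (trans (+-cong (eq (+ 0)) (*-congʳ y≈z)) (sym (h-step z zs -[1+ 0 ])))
  h-∷-cong {y} {z} {ys} {zs} y≈z eq (+ suc k) =
    trans (h-step y ys (+ k)) (trans
        (+-cong (eq (+ suc k)) (*-cong y≈z (h-∷-cong y≈z eq (+ k)))) (sym (h-step z zs (+ k))))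

  -- This is multiplication of the generating function by (1 - wx)(1 - zx). The coefficients are
  -- symmetric in w and z, which yields `h-swap`, and for reciprocal w and z the quadratic is
  -- palindromic, which yields `antisym-recurrent`.
  h-step₂ : ∀ w z zs k → h R (ℤ.suc (ℤ.suc k)) (w ∷ z ∷ zs) ≈
    h R (ℤ.suc (ℤ.suc k)) zs + ((w + z) * h R (ℤ.suc k) (w ∷ z ∷ zs) - (w * z) * h R k (w ∷ z ∷ zs))
  h-step₂ w z zs k = begin
    H (ℤ.suc (ℤ.suc k))
      ≈⟨ trans (h-step w (z ∷ zs) (ℤ.suc k)) (+-congʳ (h-step z zs (ℤ.suc k))) ⟩
    (h₀ + z * h₁) + w * H (ℤ.suc k)
      ≈⟨ solve 6 (λ h₀ z h₁ w H₁ H₀ → (h₀ :+ z :* h₁) :+ w :* H₁ :=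
           h₀ :+ (w :* H₁ :+ z :* (h₁ :+ w :* H₀) :- (w :* z) :* H₀)) refl h₀ z h₁ w (H (ℤ.suc k)) (H k) ⟩
    h₀ + (w * H (ℤ.suc k) + z * (h₁ + w * H k) - (w * z) * H k)
      ≈⟨ +-congˡ (+-congʳ (+-congˡ (*-congˡ (sym (h-step w (z ∷ zs) k))))) ⟩
    h₀ + (w * H (ℤ.suc k) + z * H (ℤ.suc k) - (w * z) * H k)
      ≈⟨ +-congˡ (+-congʳ (sym (distribʳ (H (ℤ.suc k)) w z))) ⟩
    h₀ + ((w + z) * H (ℤ.suc k) - (w * z) * H k) ∎
    where
    H : ℤ → Carrier
    H k = h R k (w ∷ z ∷ zs)
    h₀ h₁ : Carrier
    h₀ = h R (ℤ.suc (ℤ.suc k)) zs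
    h₁ = h R (ℤ.suc k) (z ∷ zs)

  -- Both sides satisfy the same second-order recurrence and vanish at -2 and -1; the induction
  -- carries two consecutive degrees.
  h-swap : ∀ w z zs k → h R k (w ∷ z ∷ zs) ≈ h R k (z ∷ w ∷ zs)
  h-swap w z zs -[1+ k ] = refl
  h-swap w z zs (+ k) = proj₁ (go k)
    where
    step : ∀ k → h R k (w ∷ z ∷ zs) ≈ h R k (z ∷ w ∷ zs) →
           h R (ℤ.suc k) (w ∷ z ∷ zs) ≈ h R (ℤ.suc k) (z ∷ w ∷ zs) →
           h R (ℤ.suc (ℤ.suc k)) (w ∷ z ∷ zs) ≈ h R (ℤ.suc (ℤ.suc k)) (z ∷ w ∷ zs)
    step k eq₀ eq₁ = trans (h-step₂ w z zs k) (trans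
      (+-congˡ (+-cong (*-cong (+-comm w z) eq₁) (-‿cong (*-cong (*-comm w z) eq₀))))
      (sym (h-step₂ z w zs k)))
    go : ∀ k → (h R (+ k) (w ∷ z ∷ zs) ≈ h R (+ k) (z ∷ w ∷ zs)) ×
               (h R (+ suc k) (w ∷ z ∷ zs) ≈ h R (+ suc k) (z ∷ w ∷ zs))
    go zero = let e = step -[1+ 1 ] refl refl in e , step -[1+ 0 ] refl e
    go (suc k) = let e₀ , e₁ = go k in e₁ , step (+ k) e₀ e₁

  h-resp-↭ : ∀ {ys zs} → ys ↭ zs → ∀ k → h R k ys ≈ h R k zs
  h-resp-↭ (↭.refl []) k = refl
  h-resp-↭ (↭.refl (y≈z ∷ eq)) k = h-∷-cong y≈z (h-resp-↭ (↭.refl eq)) k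
  h-resp-↭ (↭.prep y≈z p) k = h-∷-cong y≈z (h-resp-↭ p) k
  h-resp-↭ (↭.swap {ys} {zs} {x} {y} {x′} {y′} eq₁ eq₂ p) k = trans (h-swap x y ys k)
    (h-∷-cong eq₂ (h-∷-cong eq₁ (h-resp-↭ p)) k)
  h-resp-↭ (↭.trans p q) k = trans (h-resp-↭ p k) (h-resp-↭ q k)

  hℕ-scale : ∀ a zs k → hℕ R k (scale R a zs) ≈ pow R a k * hℕ R k zs
  hℕ-scale a [] zero = sym (*-identityˡ 1#)
  hℕ-scale a [] (suc k) = sym (zeroʳ _)
  hℕ-scale a (z ∷ zs) zero =
    trans (+-congʳ (*-congˡ (hℕ-scale a zs zero))) (solve 1 (λ x → con (+ 1) :* (con (+ 1) :* x) :+ con (+ 0) :=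
        con (+ 1) :* (con (+ 1) :* x :+ con (+ 0))) refl (hℕ R 0 zs))
  hℕ-scale a (z ∷ zs) (suc k) = begin
    hℕ R (suc k) (scale R a (z ∷ zs))
      ≈⟨ h-step (a * z) (scale R a zs) (+ k) ⟩
    hℕ R (suc k) (scale R a zs) + (a * z) * hℕ R k (scale R a (z ∷ zs))
      ≈⟨ +-cong (hℕ-scale a zs (suc k)) (*-congˡ (hℕ-scale a (z ∷ zs) k)) ⟩
    (a * pow R a k) * hℕ R (suc k) zs + (a * z) * (pow R a k * hℕ R k (z ∷ zs))
      ≈⟨ solve 5 (λ a p x z y → (a :* p) :* x :+ (a :* z) :* (p :* y) := (a :* p) :* (x :+ z :* y))
          refl a (pow R a k) _ z _ ⟩
    (a * pow R a k) * (hℕ R (suc k) zs + z * hℕ R k (z ∷ zs))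
      ≈⟨ *-congˡ (sym (h-step z zs (+ k))) ⟩
    pow R a (suc k) * hℕ R (suc k) (z ∷ zs) ∎

  -- Writing the index as a difference m - n gives the sign as the natural power (-1)^(m+n), which
  -- makes sense for negative indices too.
  h-negate : ∀ zs m n → h R (m ℤ.⊖ n) (scale R (- 1#) zs) ≈ sgn (m ℕ.+ n) * h R (m ℤ.⊖ n) zs
  h-negate zs m zero = trans (hℕ-scale (- 1#) zs m) (*-congʳ (reflexive (≡.cong sgn (≡.sym (ℕ.+-identityʳ m)))))
  h-negate zs zero (suc n) = sym (zeroʳ _)
  h-negate zs (suc m) (suc n) rewrite ℤ.[1+m]⊖[1+n]≡m⊖n m n | ℕ.+-suc m n =
    trans (h-negate zs m n) (*-congʳ (solve 1 (λ s → s := (:- con (+ 1)) :* ((:- con (+ 1)) :* s)) refl _))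

  -- The coefficients of ∏ (x − z) over the z in the list, constant term first.
  charPoly : List Carrier → ℕ → Carrier
  charPoly [] zero = 1#
  charPoly [] (suc i) = 0#
  charPoly (z ∷ zs) zero = - (z * charPoly zs zero)
  charPoly (z ∷ zs) (suc i) = charPoly zs i - z * charPoly zs (suc i)

  charPoly-above : ∀ zs i → length zs ℕ.< i → charPoly zs i ≈ 0#
  charPoly-above [] (suc i) lt = refl
  charPoly-above (z ∷ zs) (suc i) (s≤s lt) = begin
    charPoly zs i - z * charPoly zs (suc i)
      ≈⟨ +-cong (charPoly-above zs i lt) (-‿cong (*-congˡ (charPoly-above zs (suc i) (ℕ.m<n⇒m<1+n lt)))) ⟩
    0# - z * 0#
      ≈⟨ solve 1 (λ z → con (+ 0) :- z :* con (+ 0) := con (+ 0)) refl z ⟩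
    0# ∎

  charPoly-monic : ∀ zs → charPoly zs (length zs) ≈ 1#
  charPoly-monic [] = refl
  charPoly-monic (z ∷ zs) = begin
    charPoly zs (length zs) - z * charPoly zs (suc (length zs))
      ≈⟨ +-cong (charPoly-monic zs) (-‿cong (*-congˡ (charPoly-above zs _ ℕ.≤-refl))) ⟩
    1# - z * 0#
      ≈⟨ solve 1 (λ z → con (+ 1) :- z :* con (+ 0) := con (+ 1)) refl z ⟩
    1# ∎

  Recurrent : ℕ → (ℕ → Carrier) → (ℤ → Carrier) → Set ℓ
  Recurrent N p f = ∀ k → ∑ {suc N} (λ i → p (toℕ i) * f (+ toℕ i ℤ.+ k)) ≈ 0#

  ∑-last : ∀ n (f : ℕ → Carrier) → ∑ {suc n} (f ∘ toℕ) ≈ ∑ {n} (f ∘ toℕ) + f n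
  ∑-last zero f = +-comm _ _
  ∑-last (suc n) f = trans (+-congˡ (∑-last n (f ∘ suc))) (sym (+-assoc _ _ _))

  -- With S the shift of sequences, the polynomial of `z ∷ zs` evaluated at S is the polynomial of
  -- `zs` at S composed with S - z, and `f′` is (S - z)f.
  recurrent-∷ : ∀ z zs (f f′ : ℤ → Carrier) → (∀ k → f (ℤ.suc k) - z * f k ≈ f′ k) →
    Recurrent (length zs) (charPoly zs) f′ → Recurrent (suc (length zs)) (charPoly (z ∷ zs)) f
  recurrent-∷ z zs f f′ eq rec k = begin
    - (z * p 0) * f (+ 0 ℤ.+ k) + ∑ {suc N} (λ i → (p (toℕ i) - z * p (suc (toℕ i))) * f (+ suc (toℕ i) ℤ.+ k))
      ≈⟨ +-congˡ (∑-cong {suc N} (λ i → solve 4 (λ a z b f → (a :- z :* b) :* f := (:- z) :* (b :* f) :+ a :* f)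
          refl (p (toℕ i)) z (p (suc (toℕ i))) (f (+ suc (toℕ i) ℤ.+ k)))) ⟩
    - (z * p 0) * f (+ 0 ℤ.+ k) + ∑ {suc N} (λ i → (- z) * q (suc (toℕ i)) + p (toℕ i) * f (+ suc (toℕ i) ℤ.+ k))
      ≈⟨ +-congˡ (∑-linear {suc N} (- z) (λ i → q (suc (toℕ i))) (λ i → p (toℕ i) * f (+ suc (toℕ i) ℤ.+ k))) ⟩
    - (z * p 0) * f (+ 0 ℤ.+ k) + ((- z) * S₁ + S₂)
      ≈⟨ solve 5 (λ z p f s t → (:- (z :* p)) :* f :+ ((:- z) :* s :+ t) := (:- z) :* (p :* f :+ s) :+ t)
          refl z (p 0) (f (+ 0 ℤ.+ k)) S₁ S₂ ⟩
    (- z) * ∑ {suc (suc N)} (q ∘ toℕ) + S₂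
      -- The extra last term has the coefficient of `charPoly zs` above its degree, which is 0.
      ≈⟨ +-congʳ (*-congˡ (trans (∑-last (suc N) q) (trans (+-congˡ
          (trans (*-congʳ (charPoly-above zs _ ℕ.≤-refl)) (zeroˡ _))) (+-identityʳ _)))) ⟩
    (- z) * ∑ {suc N} (q ∘ toℕ) + S₂
      ≈⟨ sym (∑-linear {suc N} (- z) (q ∘ toℕ) (λ i → p (toℕ i) * f (+ suc (toℕ i) ℤ.+ k))) ⟩
    ∑ {suc N} (λ i → (- z) * q (toℕ i) + p (toℕ i) * f (+ suc (toℕ i) ℤ.+ k))
      ≈⟨ ∑-cong {suc N} (λ i → term (toℕ i)) ⟩
    ∑ {suc N} (λ i → p (toℕ i) * f′ (+ toℕ i ℤ.+ k))
      ≈⟨ rec k ⟩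
    0# ∎
    where
    N : ℕ
    N = length zs
    p q : ℕ → Carrier
    p = charPoly zs
    q i = p i * f (+ i ℤ.+ k)
    S₁ S₂ : Carrier
    S₁ = ∑ {suc N} (λ i → q (suc (toℕ i)))
    S₂ = ∑ {suc N} (λ i → p (toℕ i) * f (+ suc (toℕ i) ℤ.+ k))
    term : ∀ i → (- z) * q i + p i * f (+ suc i ℤ.+ k) ≈ p i * f′ (+ i ℤ.+ k)
    term i = begin
      (- z) * q i + p i * f (+ suc i ℤ.+ k)
        ≡⟨ ≡.cong (λ l → (- z) * q i + p i * f l) (ℤ.+-assoc (+ 1) (+ i) k) ⟩
      (- z) * (p i * f (+ i ℤ.+ k)) + p i * f (ℤ.suc (+ i ℤ.+ k))
        ≈⟨ solve 4 (λ z p a b → (:- z) :* (p :* a) :+ p :* b := p :* (b :- z :* a))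
            refl z (p i) (f (+ i ℤ.+ k)) (f (ℤ.suc (+ i ℤ.+ k))) ⟩
      p i * (f (ℤ.suc (+ i ℤ.+ k)) - z * f (+ i ℤ.+ k))
        ≈⟨ *-congˡ (eq _) ⟩
      p i * f′ (+ i ℤ.+ k) ∎

  -- Reciprocals are kept adjacent so that inductions remove a whole pair, that is, a factor x² - (w
  -- + v)x + 1. A single linear factor would not preserve the palindromic shape.
  data ReciprocalPairs : ℕ → List Carrier → Set (c Level.⊔ ℓ) where
    []  : ReciprocalPairs 0 []
    _∷_ : ∀ {w v m zs} → w * v ≈ 1# → ReciprocalPairs m zs → ReciprocalPairs (suc m) (w ∷ v ∷ zs)

  length-reciprocal : ∀ {m zs} → ReciprocalPairs m zs → length zs ≡ m ℕ.+ m
  length-reciprocal [] = ≡.refl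
  length-reciprocal {suc m} (eq ∷ rp) = ≡.cong suc (≡.trans (≡.cong suc (length-reciprocal rp)) (≡.sym (ℕ.+-suc m m)))

  charPoly-reciprocal : ∀ {m zs} → ReciprocalPairs m zs → charPoly zs 0 ≈ 1#
  charPoly-reciprocal [] = refl
  charPoly-reciprocal {zs = w ∷ v ∷ zs} (eq ∷ rp) = begin
    - (w * - (v * charPoly zs 0))
      ≈⟨ solve 3 (λ w v p → :- (w :* :- (v :* p)) := (w :* v) :* p) refl w v (charPoly zs 0) ⟩
    (w * v) * charPoly zs 0
      ≈⟨ *-cong eq (charPoly-reciprocal rp) ⟩
    1# * 1#
      ≈⟨ *-identityˡ 1# ⟩
    1# ∎

  interleave : ∀ {W V} → Pointwise (λ w v → w * v ≈ 1#) W V →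
    ∃ λ zs → ReciprocalPairs (length W) zs × (W ++ V ↭ zs)
  interleave [] = [] , [] , ↭-refl
  interleave {w ∷ W} {v ∷ V} (eq ∷ eqs) = let zs , rp , p = interleave eqs in
    w ∷ v ∷ zs , eq ∷ rp , ↭-prep w (↭-trans (↭-shift W V) (↭-prep v p))

  -- h extended to a solution of the recurrence with characteristic polynomial ∏ (x − z) on all of ℤ:
  -- this polynomial is palindromic, so reflection about −N/2 maps solutions to solutions.
  antisym : List Carrier → ℤ → Carrier
  antisym zs k = h R k zs - h R (ℤ.- + length zs ℤ.- k) zs

  antisym-reflect : ∀ zs k → antisym zs (ℤ.- + length zs ℤ.- k) ≈ - antisym zs k
  antisym-reflect zs k = begin
    h R (-N ℤ.- k) zs - h R (-N ℤ.- (-N ℤ.- k)) zs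
      ≡⟨ ≡.cong (λ l → h R (-N ℤ.- k) zs - h R l zs) (ℤS.solve 2 (λ n k → n ℤS.:- (n ℤS.:- k) ℤS.:= k) ≡.refl -N k) ⟩
    h R (-N ℤ.- k) zs - h R k zs
      ≈⟨ solve 2 (λ a b → a :- b := :- (b :- a)) refl _ _ ⟩
    - antisym zs k ∎
    where
    module ℤS = ℤ.+-*-Solver
    -N : ℤ
    -N = ℤ.- + length zs

  -- Applying (S - w)(S - v), with S the shift, removes one pair and leaves the same construction
  -- for the shorter list, moved by 2. For the empty list h is the indicator of 0, an even sequence,
  -- so its antisymmetrisation is identically 0.
  antisym-recurrent : ∀ {m zs} → ReciprocalPairs m zs → Recurrent (length zs) (charPoly zs) (antisym zs)
  antisym-recurrent [] k = trans (+-identityʳ _) (trans (*-identityˡ _) (even (+ 0 ℤ.+ k)))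
    where
    even : ∀ k → h R k [] - h R (+ 0 ℤ.- k) [] ≈ 0#
    even (+ zero) = -‿inverseʳ _
    even (+ suc k) = -‿inverseʳ _
    even -[1+ k ] = -‿inverseʳ _
  antisym-recurrent {zs = w ∷ v ∷ zs} (eq ∷ rp) =
    recurrent-∷ w (v ∷ zs) G G₁ (λ k → refl) (recurrent-∷ v zs G₁ (antisym zs ∘ ℤ.suc ∘ ℤ.suc) second (λ k → trans
      (∑-cong {suc (length zs)} (λ i →
          *-congˡ {charPoly zs (toℕ i)} (reflexive (≡.cong (antisym zs) (shift (+ toℕ i) k)))))
      (antisym-recurrent rp (ℤ.suc (ℤ.suc k)))))
    where
    module ℤS = ℤ.+-*-Solver
    suc¹ suc² : ∀ {n} → ℤS.Polynomial n → ℤS.Polynomial n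
    suc¹ x = ℤS.con (+ 1) ℤS.:+ x
    suc² x = suc¹ (suc¹ x)
    shift : ∀ i k → ℤ.suc (ℤ.suc (i ℤ.+ k)) ≡ i ℤ.+ ℤ.suc (ℤ.suc k)
    shift = ℤS.solve 2 (λ i k → ℤS.con (+ 1) ℤS.:+ (ℤS.con (+ 1) ℤS.:+ (i ℤS.:+ k)) ℤS.:= i ℤS.:+ (ℤS.con
        (+ 1) ℤS.:+ (ℤS.con (+ 1) ℤS.:+ k))) ≡.refl
    G G₁ H : ℤ → Carrier
    G = antisym (w ∷ v ∷ zs)
    G₁ k = G (ℤ.suc k) - w * G k
    H k = h R k (w ∷ v ∷ zs)
    second : ∀ k → (G (ℤ.suc (ℤ.suc k)) - w * G (ℤ.suc k)) - v * (G (ℤ.suc k) - w * G k) ≈ antisym zs (ℤ.suc (ℤ.suc k))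
    second k = begin
      (G (ℤ.suc (ℤ.suc k)) - w * G (ℤ.suc k)) - v * (G (ℤ.suc k) - w * G k)
        ≡⟨ ≡.cong₂ (λ i j → (G (ℤ.suc (ℤ.suc k)) - w * (H (ℤ.suc k) - H i)) - v * ((H (ℤ.suc k) - H i) - w *
            (H k - H j)))
             (r₁ (+ length zs) k) (r₂ (+ length zs) k) ⟩
      ((a₂ - b₀) - w * (a₁ - b₁)) - v * ((a₁ - b₁) - w * (a₀ - b₂))
        ≈⟨ solve 8 (λ w v a₀ a₁ a₂ b₀ b₁ b₂ → ((a₂ :- b₀) :- w :* (a₁ :- b₁)) :- v :* ((a₁ :- b₁) :- w :* (a₀ :- b₂)) :=
             ((a₂ :- (w :+ v) :* a₁) :+ (w :* v) :* a₀) :- ((b₀ :- (w :+ v) :* b₁) :+ (w :* v) :* b₂))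
                 refl w v a₀ a₁ a₂ b₀ b₁ b₂ ⟩
      ((a₂ - (w + v) * a₁) + (w * v) * a₀) - ((b₀ - (w + v) * b₁) + (w * v) * b₂)
        -- The reflected values run in the opposite order; since wv = 1 the quadratic reads the same
        -- backwards, so `h-step₂` applies to them as well, starting from the lowest index `l`.
        ≈⟨ +-cong (+-congʳ (+-congʳ (h-step₂ w v zs k)))
             (-‿cong (+-congˡ (*-cong eq (trans (h-step₂ w v zs l) (+-congˡ (+-congˡ (-‿cong (*-congʳ eq)))))))) ⟩
      (((x + ((w + v) * a₁ - (w * v) * a₀)) - (w + v) * a₁) + (w * v) * a₀) -
        ((b₀ - (w + v) * b₁) + 1# * (y + ((w + v) * b₁ - 1# * b₀)))
        ≈⟨ solve 8 (λ w v a₀ a₁ b₀ b₁ x y →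
            (((x :+ ((w :+ v) :* a₁ :- (w :* v) :* a₀)) :- (w :+ v) :* a₁) :+ (w :* v) :* a₀) :-
             ((b₀ :- (w :+ v) :* b₁) :+ con (+ 1) :* (y :+ ((w :+ v) :* b₁ :- con (+ 1) :* b₀))) := x :- y)
                 refl w v a₀ a₁ b₀ b₁ x y ⟩
      x - y
        ≡⟨ ≡.cong (λ i → x - h R i zs) (≡.sym (r₀ (+ length zs) k)) ⟩
      antisym zs (ℤ.suc (ℤ.suc k)) ∎
      where
      l : ℤ
      l = ℤ.- + length (w ∷ v ∷ zs) ℤ.- ℤ.suc (ℤ.suc k)
      a₀ a₁ a₂ b₀ b₁ b₂ x y : Carrier
      a₀ = H k
      a₁ = H (ℤ.suc k)
      a₂ = H (ℤ.suc (ℤ.suc k))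
      b₀ = H l
      b₁ = H (ℤ.suc l)
      b₂ = H (ℤ.suc (ℤ.suc l))
      x = h R (ℤ.suc (ℤ.suc k)) zs
      y = h R (ℤ.suc (ℤ.suc l)) zs
      r₀ : ∀ n k → ℤ.- n ℤ.- ℤ.suc (ℤ.suc k) ≡ ℤ.suc (ℤ.suc (ℤ.- ℤ.suc (ℤ.suc n) ℤ.- ℤ.suc (ℤ.suc k)))
      r₀ = ℤS.solve 2 (λ n k → ℤS.:- n ℤS.:- suc² k ℤS.:= suc² (ℤS.:- suc² n ℤS.:- suc² k)) ≡.refl
      r₁ : ∀ n k → ℤ.- ℤ.suc (ℤ.suc n) ℤ.- ℤ.suc k ≡ ℤ.suc (ℤ.- ℤ.suc (ℤ.suc n) ℤ.- ℤ.suc (ℤ.suc k))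
      r₁ = ℤS.solve 2 (λ n k → ℤS.:- suc² n ℤS.:- suc¹ k ℤS.:= suc¹ (ℤS.:- suc² n ℤS.:- suc² k)) ≡.refl
      r₂ : ∀ n k → ℤ.- ℤ.suc (ℤ.suc n) ℤ.- k ≡ ℤ.suc (ℤ.suc (ℤ.- ℤ.suc (ℤ.suc n) ℤ.- ℤ.suc (ℤ.suc k)))
      r₂ = ℤS.solve 2 (λ n k → ℤS.:- suc² n ℤS.:- k ℤS.:= suc² (ℤS.:- suc² n ℤS.:- suc² k)) ≡.refl

  -- The witness encodes k > -N in the form that makes the reflected value of `h` reduce to 0.
  antisym≈h : ∀ zs k → (∃ λ j → ℤ.- + length zs ℤ.- k ≡ -[1+ j ]) → antisym zs k ≈ h R k zs
  antisym≈h zs k (j , eq) = begin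
    h R k zs - h R (ℤ.- + length zs ℤ.- k) zs
      ≡⟨ ≡.cong (λ i → h R k zs - h R i zs) eq ⟩
    h R k zs - 0#
      ≈⟨ solve 1 (λ x → x :- con (+ 0) := x) refl _ ⟩
    h R k zs ∎

  -- Companion matrices and the common shift of the columns.

  companion : ∀ n → (ℕ → Carrier) → Matrix (suc n) (suc n)
  companion n p i j = δ (toℕ i) (suc (toℕ j)) - p (toℕ i) * δ (toℕ j) n

  toℕ-punchIn-fromℕ : ∀ n (b : Fin n) → toℕ (punchIn (Fin.fromℕ n) b) ≡ toℕ b
  toℕ-punchIn-fromℕ (suc n) zero = ≡.refl
  toℕ-punchIn-fromℕ (suc n) (suc b) = ≡.cong suc (toℕ-punchIn-fromℕ n b)

  -- The first row is zero except for -p 0 in the last column, and deleting that row and column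
  -- leaves the identity.
  det-companion : ∀ n p → Det (companion n p) ≈ - (sgn n * p 0)
  det-companion n p = begin
    Det C
      ≈⟨ ∑-cong {suc n} (λ j → trans
           (solve 4 (λ s q d e → s :* ((con (+ 0) :- q :* d) :* e) := (:- (s :* (q :* e))) :* d) refl
             (sgn (toℕ j)) (p 0) (δ (toℕ j) n) (Det (minor C j)))
           (*-congˡ (reflexive (≡.cong (δ (toℕ j)) (≡.sym (Fin.toℕ-fromℕ n)))))) ⟩
    ∑ {suc n} (λ j → X j * 𝟙 j (Fin.fromℕ n))
      ≈⟨ ∑-𝟙 X (Fin.fromℕ n) ⟩
    - (sgn (toℕ (Fin.fromℕ n)) * (p 0 * Det (minor C (Fin.fromℕ n))))
      ≈⟨ -‿cong (*-cong (reflexive (≡.cong sgn (Fin.toℕ-fromℕ n)))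
           (trans (*-congˡ (trans (det-cong identity) (det-𝟙 n))) (*-identityʳ _))) ⟩
    - (sgn n * p 0) ∎
    where
    C : Matrix (suc n) (suc n)
    C = companion n p
    X : Fin (suc n) → Carrier
    X j = - (sgn (toℕ j) * (p 0 * Det (minor C j)))
    identity : minor C (Fin.fromℕ n) ≋ 𝟙
    identity a b rewrite toℕ-punchIn-fromℕ n b | δ-off {toℕ b} {n} (ℕ.<⇒≢ (Fin.toℕ<n b)) =
      solve 2 (λ d q → d :- q :* con (+ 0) := d) refl (δ (toℕ a) (toℕ b)) (p (suc (toℕ a)))

  window : ∀ {m} N → (ℤ → Carrier) → (Fin m → ℤ) → Matrix m N
  window N f c i j = f (+ toℕ j ℤ.+ c i)

  -- The subdiagonal of ones moves every entry one place to the left; the last column forms minus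
  -- the sum of the p_k f(k + c) with k ≤ n, which the monic recurrence identifies with the entry
  -- entering from the right.
  window-⊗-companion : ∀ {m} n p f → Recurrent (suc n) p f → p (suc n) ≈ 1# → ∀ (c : Fin m → ℤ) →
    window (suc n) f c ⊗ companion n p ≋ window (suc n) f (ℤ.suc ∘ c)
  window-⊗-companion n p f rec monic c i j = begin
    ∑ {suc n} (λ k → a k * (δ (toℕ k) (suc (toℕ j)) - p (toℕ k) * δ (toℕ j) n))
      ≈⟨ ∑-cong {suc n} (λ k → solve 4 (λ a d p e → a :* (d :- p :* e) := (:- e) :* (p :* a) :+ a :* d) refl
           (a k) (δ (toℕ k) (suc (toℕ j))) (p (toℕ k)) (δ (toℕ j) n)) ⟩
    ∑ {suc n} (λ k → (- δ (toℕ j) n) * (p (toℕ k) * a k) + a k * δ (toℕ k) (suc (toℕ j)))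
      ≈⟨ ∑-linear {suc n} (- δ (toℕ j) n) (λ k → p (toℕ k) * a k) (λ k → a k * δ (toℕ k) (suc (toℕ j))) ⟩
    (- δ (toℕ j) n) * P + Q
      ≈⟨ cases ⟩
    f (+ suc (toℕ j) ℤ.+ c i)
      ≡⟨ ≡.cong f (ℤS.solve 2 (λ j c → (ℤS.con (+ 1) ℤS.:+ j) ℤS.:+ c ℤS.:= j ℤS.:+ (ℤS.con (+ 1) ℤS.:+ c))
          ≡.refl (+ toℕ j) (c i)) ⟩
    f (+ toℕ j ℤ.+ ℤ.suc (c i)) ∎
    where
    module ℤS = ℤ.+-*-Solver
    a : Fin (suc n) → Carrier
    a k = f (+ toℕ k ℤ.+ c i)
    P Q : Carrier
    P = ∑ {suc n} (λ k → p (toℕ k) * a k)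
    Q = ∑ {suc n} (λ k → a k * δ (toℕ k) (suc (toℕ j)))
    last : P + f (+ suc n ℤ.+ c i) ≈ 0#
    last = begin
      P + f (+ suc n ℤ.+ c i)                   ≈⟨ +-congˡ (sym (trans (*-congʳ monic) (*-identityˡ _))) ⟩
      P + p (suc n) * f (+ suc n ℤ.+ c i)       ≈⟨ sym (∑-last (suc n) (λ k → p k * f (+ k ℤ.+ c i))) ⟩
      ∑ {suc (suc n)} (λ k → p (toℕ k) * f (+ toℕ k ℤ.+ c i)) ≈⟨ rec (c i) ⟩
      0# ∎
    cases : (- δ (toℕ j) n) * P + Q ≈ f (+ suc (toℕ j) ℤ.+ c i)
    cases with toℕ j ℕ.≟ n
    ... | yes j≡n = begin
      (- δ (toℕ j) n) * P + Q
        ≈⟨ +-cong (*-congʳ (-‿cong (reflexive (≡.trans (≡.cong (λ x → δ x n) j≡n) (δ-diag n)))))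
             (∑-zero {suc n} (λ k → trans (*-congˡ {a k} (reflexive (δ-off (ℕ.<⇒≢ (≡.subst
                 (λ x → toℕ k ℕ.< suc x) (≡.sym j≡n) (Fin.toℕ<n k)))))) (zeroʳ (a k)))) ⟩
      (- 1#) * P + 0#
        ≈⟨ solve 2 (λ p x → (:- con (+ 1)) :* p :+ con (+ 0) := x :- (p :+ x)) refl P _ ⟩
      f (+ suc n ℤ.+ c i) - (P + f (+ suc n ℤ.+ c i))
        ≈⟨ +-congˡ (-‿cong last) ⟩
      f (+ suc n ℤ.+ c i) - 0#
        ≈⟨ solve 1 (λ x → x :- con (+ 0) := x) refl _ ⟩
      f (+ suc n ℤ.+ c i)
        ≡⟨ ≡.cong (λ x → f (+ suc x ℤ.+ c i)) (≡.sym j≡n) ⟩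
      f (+ suc (toℕ j) ℤ.+ c i) ∎
    ... | no j≢n = begin
      (- δ (toℕ j) n) * P + Q
        ≈⟨ +-cong (*-congʳ (-‿cong (reflexive (δ-off j≢n))))
             (∑-cong {suc n} (λ k → *-congˡ {a k} (reflexive (≡.cong (δ (toℕ k)) (≡.sym (Fin.toℕ-fromℕ< lt)))))) ⟩
      (- 0#) * P + ∑ {suc n} (λ k → a k * 𝟙 k (Fin.fromℕ< lt))
        ≈⟨ +-congˡ (∑-𝟙 a (Fin.fromℕ< lt)) ⟩
      (- 0#) * P + a (Fin.fromℕ< lt)
        ≈⟨ solve 2 (λ p x → (:- con (+ 0)) :* p :+ x := x) refl P _ ⟩
      a (Fin.fromℕ< lt)
        ≡⟨ ≡.cong (λ x → f (+ x ℤ.+ c i)) (Fin.toℕ-fromℕ< lt) ⟩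
      f (+ suc (toℕ j) ℤ.+ c i) ∎
      where
      lt : suc (toℕ j) ℕ.< suc n
      lt = s≤s (ℕ.≤∧≢⇒< (ℕ.≤-pred (Fin.toℕ<n j)) j≢n)

  det-window-suc : ∀ m p f → Recurrent (m ℕ.+ m) p f → p 0 ≈ 1# → p (m ℕ.+ m) ≈ 1# →
    ∀ (c : Fin (m ℕ.+ m) → ℤ) → Det (window (m ℕ.+ m) f (ℤ.suc ∘ c)) ≈ Det (window (m ℕ.+ m) f c)
  det-window-suc zero p f rec p₀ monic c = refl
  det-window-suc (suc m) p f rec p₀ monic c = begin
    Det (window N f (ℤ.suc ∘ c))
        ≈⟨ sym (det-cong (window-⊗-companion (m ℕ.+ suc m) p f rec monic c)) ⟩
    Det (window N f c ⊗ companion (m ℕ.+ suc m) p)       ≈⟨ det-⊗ (window N f c) (companion (m ℕ.+ suc m) p) ⟩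
    Det (window N f c) * Det (companion (m ℕ.+ suc m) p) ≈⟨ *-congˡ (trans (det-companion (m ℕ.+ suc m) p) unit) ⟩
    Det (window N f c) * 1#                             ≈⟨ *-identityʳ _ ⟩
    Det (window N f c) ∎
    where
    N : ℕ
    N = suc m ℕ.+ suc m
    -- The size is even, so `sgn` is taken at an odd number and its sign cancels the one in front.
    unit : - (sgn (m ℕ.+ suc m) * p 0) ≈ 1#
    unit = begin
      - (sgn (m ℕ.+ suc m) * p 0)   ≈⟨ -‿cong (*-cong (reflexive (≡.cong sgn (ℕ.+-suc m m))) p₀) ⟩
      - ((- 1# * sgn (m ℕ.+ m)) * 1#)  ≈⟨ -‿cong (*-congʳ (*-congˡ (sgn-even m))) ⟩
      - ((- 1# * 1#) * 1#)          ≈⟨ solve 0 (:- (((:- con (+ 1)) :* con (+ 1)) :* con (+ 1)) := con (+ 1)) refl ⟩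
      1# ∎

  det-window-+ : ∀ m p f → Recurrent (m ℕ.+ m) p f → p 0 ≈ 1# → p (m ℕ.+ m) ≈ 1# →
    ∀ s (c : Fin (m ℕ.+ m) → ℤ) → Det (window (m ℕ.+ m) f (λ i → + s ℤ.+ c i)) ≈ Det (window (m ℕ.+ m) f c)
  det-window-+ m p f rec p₀ monic zero c = det-cong (λ i j → reflexive (≡.cong
      (λ l → f (+ toℕ j ℤ.+ l)) (ℤ.+-identityˡ (c i))))
  det-window-+ m p f rec p₀ monic (suc s) c = begin
    Det (window (m ℕ.+ m) f (λ i → + suc s ℤ.+ c i))
      ≈⟨ det-cong (λ i j → reflexive (≡.cong (λ l → f (+ toℕ j ℤ.+ l)) (ℤ.+-assoc (+ 1) (+ s) (c i)))) ⟩
    Det (window (m ℕ.+ m) f (λ i → ℤ.suc (+ s ℤ.+ c i)))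
      ≈⟨ det-window-suc m p f rec p₀ monic (λ i → + s ℤ.+ c i) ⟩
    Det (window (m ℕ.+ m) f (λ i → + s ℤ.+ c i))
      ≈⟨ det-window-+ m p f rec p₀ monic s c ⟩
    Det (window (m ℕ.+ m) f c) ∎

-- Matrices negated by a half-turn, and the factorisation of their determinants.

module Factorization {c ℓ : Level} (R : CommutativeRing c ℓ) where
  open CommutativeRing R hiding (zero)
  open IntegerCoefficients R
  open Determinants R
  open Recurrences R
  open import Relation.Binary.Reasoning.Setoid setoid

  𝟙-injective : ∀ {m n} (f : Fin m → Fin n) → (∀ {i j} → f i ≡ f j → i ≡ j) → ∀ i j → 𝟙 (f i) (f j) ≡ 𝟙 i j
  𝟙-injective f inj i j with i Fin.≟ j
  ... | yes ≡.refl = ≡.trans (δ-diag (toℕ (f i))) (≡.sym (δ-diag (toℕ i)))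
  ... | no i≢j = ≡.trans (δ-off (i≢j ∘ inj ∘ Fin.toℕ-injective)) (≡.sym (δ-off (i≢j ∘ Fin.toℕ-injective)))

  opposite-injective : ∀ {m} {i j : Fin m} → opposite i ≡ opposite j → i ≡ j
  opposite-injective {i = i} {j} eq =
    ≡.trans (≡.sym (Fin.opposite-involutive i)) (≡.trans (≡.cong opposite eq) (Fin.opposite-involutive j))

  𝟙-↑ˡ-↑ʳ : ∀ m {n} (i : Fin m) (j : Fin n) → 𝟙 (i ↑ˡ n) (m ↑ʳ j) ≡ 0#
  𝟙-↑ˡ-↑ʳ m {n} i j = δ-off λ eq → ℕ.<⇒≢
    (ℕ.<-≤-trans (Fin.toℕ<n i) (ℕ.m≤m+n m (toℕ j)))
    (≡.trans (≡.sym (Fin.toℕ-↑ˡ i n)) (≡.trans eq (Fin.toℕ-↑ʳ m j)))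

  module _ (m : ℕ) where
    -- [[I, 0], [I, J]] and [[J, 0], [I, I]] in block form, with J the reversal.
    rowOps colOps : Matrix (m ℕ.+ m) (m ℕ.+ m)
    rowOps i k = [ (λ a → 𝟙 (a ↑ˡ m) k) , (λ a → 𝟙 (a ↑ˡ m) k + 𝟙 (m ↑ʳ opposite a) k) ]′ (splitAt m i)
    colOps k j = [ (λ a → 𝟙 k (opposite a ↑ˡ m) + 𝟙 k (m ↑ʳ a)) , (λ a → 𝟙 k (m ↑ʳ a)) ]′ (splitAt m j)

    rowOps-⊗ˡ : ∀ (T : Matrix (m ℕ.+ m) (m ℕ.+ m)) i j → (rowOps ⊗ T) (i ↑ˡ m) j ≈ T (i ↑ˡ m) j
    rowOps-⊗ˡ T i j rewrite Fin.splitAt-↑ˡ m i m = ⊗-identityˡ T (i ↑ˡ m) j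

    rowOps-⊗ʳ : ∀ (T : Matrix (m ℕ.+ m) (m ℕ.+ m)) i j →
      (rowOps ⊗ T) (m ↑ʳ i) j ≈ T (i ↑ˡ m) j + T (m ↑ʳ opposite i) j
    rowOps-⊗ʳ T i j rewrite Fin.splitAt-↑ʳ m m i = begin
      ∑ {m ℕ.+ m} (λ k → (𝟙 (i ↑ˡ m) k + 𝟙 (m ↑ʳ opposite i) k) * T k j)
        ≈⟨ ∑-cong {m ℕ.+ m} (λ k → distribʳ (T k j) _ _) ⟩
      ∑ {m ℕ.+ m} (λ k → 𝟙 (i ↑ˡ m) k * T k j + 𝟙 (m ↑ʳ opposite i) k * T k j)
        ≈⟨ ∑-+ {m ℕ.+ m} (λ k → 𝟙 (i ↑ˡ m) k * T k j) (λ k → 𝟙 (m ↑ʳ opposite i) k * T k j) ⟩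
      (𝟙 ⊗ T) (i ↑ˡ m) j + (𝟙 ⊗ T) (m ↑ʳ opposite i) j
        ≈⟨ +-cong (⊗-identityˡ T (i ↑ˡ m) j) (⊗-identityˡ T (m ↑ʳ opposite i) j) ⟩
      T (i ↑ˡ m) j + T (m ↑ʳ opposite i) j ∎

    ⊗-colOpsˡ : ∀ (T : Matrix (m ℕ.+ m) (m ℕ.+ m)) i j →
      (T ⊗ colOps) i (j ↑ˡ m) ≈ T i (opposite j ↑ˡ m) + T i (m ↑ʳ j)
    ⊗-colOpsˡ T i j rewrite Fin.splitAt-↑ˡ m j m = begin
      ∑ {m ℕ.+ m} (λ k → T i k * (𝟙 k (opposite j ↑ˡ m) + 𝟙 k (m ↑ʳ j)))
        ≈⟨ ∑-cong {m ℕ.+ m} (λ k → distribˡ (T i k) _ _) ⟩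
      ∑ {m ℕ.+ m} (λ k → T i k * 𝟙 k (opposite j ↑ˡ m) + T i k * 𝟙 k (m ↑ʳ j))
        ≈⟨ ∑-+ {m ℕ.+ m} (λ k → T i k * 𝟙 k (opposite j ↑ˡ m)) (λ k → T i k * 𝟙 k (m ↑ʳ j)) ⟩
      ∑ {m ℕ.+ m} (λ k → T i k * 𝟙 k (opposite j ↑ˡ m)) + ∑ {m ℕ.+ m} (λ k → T i k * 𝟙 k (m ↑ʳ j))
        ≈⟨ +-cong (∑-𝟙 (T i) (opposite j ↑ˡ m)) (∑-𝟙 (T i) (m ↑ʳ j)) ⟩
      T i (opposite j ↑ˡ m) + T i (m ↑ʳ j) ∎

    ⊗-colOpsʳ : ∀ (T : Matrix (m ℕ.+ m) (m ℕ.+ m)) i j → (T ⊗ colOps) i (m ↑ʳ j) ≈ T i (m ↑ʳ j)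
    ⊗-colOpsʳ T i j rewrite Fin.splitAt-↑ʳ m m j = ∑-𝟙 (T i) (m ↑ʳ j)

    rev rev′ : Matrix m m
    rev i j = 𝟙 (opposite i) j
    rev′ i j = 𝟙 i (opposite j)

    det-rowOps : Det rowOps ≈ Det rev
    det-rowOps = trans (det-blockLower m 𝟙 rev rowOps ul ur lr) (trans (*-congʳ (det-𝟙 m)) (*-identityˡ _))
      where
      ul : ∀ i j → rowOps (i ↑ˡ m) (j ↑ˡ m) ≈ 𝟙 i j
      ul i j rewrite Fin.splitAt-↑ˡ m i m = reflexive (𝟙-injective (_↑ˡ m) (Fin.↑ˡ-injective m _ _) i j)
      ur : ∀ i j → rowOps (i ↑ˡ m) (m ↑ʳ j) ≈ 0#
      ur i j rewrite Fin.splitAt-↑ˡ m i m = reflexive (𝟙-↑ˡ-↑ʳ m i j)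
      lr : ∀ i j → rowOps (m ↑ʳ i) (m ↑ʳ j) ≈ rev i j
      lr i j rewrite Fin.splitAt-↑ʳ m m i = trans
        (+-cong (reflexive (𝟙-↑ˡ-↑ʳ m i j)) (reflexive (𝟙-injective (m ↑ʳ_) (Fin.↑ʳ-injective m _ _) (opposite i) j)))
        (+-identityˡ _)

    det-colOps : Det colOps ≈ Det rev′
    det-colOps = trans (det-blockLower m rev′ 𝟙 colOps ul ur lr) (trans (*-congˡ (det-𝟙 m)) (*-identityʳ _))
      where
      ul : ∀ i j → colOps (i ↑ˡ m) (j ↑ˡ m) ≈ rev′ i j
      ul i j rewrite Fin.splitAt-↑ˡ m j m = trans
        (+-cong (reflexive (𝟙-injective (_↑ˡ m) (Fin.↑ˡ-injective m _ _) i (opposite j))) (reflexive (𝟙-↑ˡ-↑ʳ m i j)))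
        (+-identityʳ _)
      ur : ∀ i j → colOps (i ↑ˡ m) (m ↑ʳ j) ≈ 0#
      ur i j rewrite Fin.splitAt-↑ʳ m m j = reflexive (𝟙-↑ˡ-↑ʳ m i j)
      lr : ∀ i j → colOps (m ↑ʳ i) (m ↑ʳ j) ≈ 𝟙 i j
      lr i j rewrite Fin.splitAt-↑ʳ m m j = reflexive (𝟙-injective (m ↑ʳ_) (Fin.↑ʳ-injective m _ _) i j)

    -- The sign of det J varies with m. As J enters once through `rowOps` and once through `colOps`,
    -- only its square has to be evaluated, and J² is the identity.
    det-rev : Det rev * Det rev′ ≈ 1#
    det-rev = begin
      Det rev * Det rev′   ≈⟨ sym (det-⊗ rev rev′) ⟩
      Det (rev ⊗ rev′)     ≈⟨ det-cong (λ i j → trans (∑-𝟙 (rev i) (opposite j))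
                                (reflexive (𝟙-injective opposite opposite-injective i j))) ⟩
      Det {m} 𝟙            ≈⟨ det-𝟙 m ⟩
      1#                   ∎

    -- In blocks T = [[BJ, A], [-JAJ, -JB]] with J the reversal. Multiplying by `colOps` on the
    -- right gives [[A + B, A], [-J(A + B), -JB]], and multiplying this by `rowOps` on the left
    -- gives [[A + B, A], [0, A - B]].
    det-centrosymmetric : (A B : Matrix m m) (T : Matrix (m ℕ.+ m) (m ℕ.+ m)) →
      (∀ i j → T (i ↑ˡ m) (j ↑ˡ m) ≈ B i (opposite j)) →
      (∀ i j → T (i ↑ˡ m) (m ↑ʳ j) ≈ A i j) →
      (∀ i j → T (m ↑ʳ i) (j ↑ˡ m) ≈ - A (opposite i) (opposite j)) →
      (∀ i j → T (m ↑ʳ i) (m ↑ʳ j) ≈ - B (opposite i) j) →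
      Det T ≈ Det (λ i j → A i j + B i j) * Det (λ i j → A i j - B i j)
    det-centrosymmetric A B T ul ur ll lr = begin
      Det T
        ≈⟨ sym (*-identityʳ _) ⟩
      Det T * 1#
        ≈⟨ *-congˡ (sym det-rev) ⟩
      Det T * (Det rev * Det rev′)
        ≈⟨ *-congˡ (*-cong (sym det-rowOps) (sym det-colOps)) ⟩
      Det T * (Det rowOps * Det colOps)
        ≈⟨ solve 3 (λ t r c → t :* (r :* c) := r :* (t :* c)) refl _ _ _ ⟩
      Det rowOps * (Det T * Det colOps)
        ≈⟨ sym (trans (det-⊗ rowOps (T ⊗ colOps)) (*-congˡ (det-⊗ T colOps))) ⟩
      Det (rowOps ⊗ (T ⊗ colOps))
        ≈⟨ det-blockUpper m (λ i j → A i j + B i j) (λ i j → A i j - B i j) (rowOps ⊗ (T ⊗ colOps)) ul′ ll′ lr′ ⟩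
      Det (λ i j → A i j + B i j) * Det (λ i j → A i j - B i j) ∎
      where
      top : ∀ i j → (T ⊗ colOps) (i ↑ˡ m) (j ↑ˡ m) ≈ A i j + B i j
      top i j = begin
        (T ⊗ colOps) (i ↑ˡ m) (j ↑ˡ m)                        ≈⟨ ⊗-colOpsˡ T (i ↑ˡ m) j ⟩
        T (i ↑ˡ m) (opposite j ↑ˡ m) + T (i ↑ˡ m) (m ↑ʳ j)    ≈⟨ +-cong (ul i (opposite j)) (ur i j) ⟩
        B i (opposite (opposite j)) + A i j                   ≡⟨ ≡.cong
            (λ l → B i l + A i j) (Fin.opposite-involutive j) ⟩
        B i j + A i j                                         ≈⟨ +-comm _ _ ⟩
        A i j + B i j                                         ∎
      ul′ : ∀ i j → (rowOps ⊗ (T ⊗ colOps)) (i ↑ˡ m) (j ↑ˡ m) ≈ A i j + B i j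
      ul′ i j = trans (rowOps-⊗ˡ (T ⊗ colOps) i (j ↑ˡ m)) (top i j)
      ll′ : ∀ i j → (rowOps ⊗ (T ⊗ colOps)) (m ↑ʳ i) (j ↑ˡ m) ≈ 0#
      ll′ i j = begin
        (rowOps ⊗ (T ⊗ colOps)) (m ↑ʳ i) (j ↑ˡ m)
          ≈⟨ rowOps-⊗ʳ (T ⊗ colOps) i (j ↑ˡ m) ⟩
        (T ⊗ colOps) (i ↑ˡ m) (j ↑ˡ m) + (T ⊗ colOps) (m ↑ʳ opposite i) (j ↑ˡ m)
          ≈⟨ +-cong (top i j) (⊗-colOpsˡ T (m ↑ʳ opposite i) j) ⟩
        (A i j + B i j) + (T (m ↑ʳ opposite i) (opposite j ↑ˡ m) + T (m ↑ʳ opposite i) (m ↑ʳ j))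
          ≈⟨ +-congˡ (+-cong (ll (opposite i) (opposite j)) (lr (opposite i) j)) ⟩
        (A i j + B i j) + (- A (opposite (opposite i)) (opposite (opposite j)) - B (opposite (opposite i)) j)
          ≡⟨ ≡.cong₂ (λ a b → (A i j + B i j) +
              (- A a b - B a j)) (Fin.opposite-involutive i) (Fin.opposite-involutive j) ⟩
        (A i j + B i j) + (- A i j - B i j)
          ≈⟨ solve 2 (λ a b → (a :+ b) :+ (:- a :- b) := con (+ 0)) refl _ _ ⟩
        0# ∎
      lr′ : ∀ i j → (rowOps ⊗ (T ⊗ colOps)) (m ↑ʳ i) (m ↑ʳ j) ≈ A i j - B i j
      lr′ i j = begin
        (rowOps ⊗ (T ⊗ colOps)) (m ↑ʳ i) (m ↑ʳ j)
          ≈⟨ rowOps-⊗ʳ (T ⊗ colOps) i (m ↑ʳ j) ⟩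
        (T ⊗ colOps) (i ↑ˡ m) (m ↑ʳ j) + (T ⊗ colOps) (m ↑ʳ opposite i) (m ↑ʳ j)
          ≈⟨ +-cong (⊗-colOpsʳ T (i ↑ˡ m) j) (⊗-colOpsʳ T (m ↑ʳ opposite i) j) ⟩
        T (i ↑ˡ m) (m ↑ʳ j) + T (m ↑ʳ opposite i) (m ↑ʳ j)
          ≈⟨ +-cong (ur i j) (lr (opposite i) j) ⟩
        A i j - B (opposite (opposite i)) j
          ≡⟨ ≡.cong (λ l → A i j - B l j) (Fin.opposite-involutive i) ⟩
        A i j - B i j ∎

-- The determinants for Schur functions and odd orthogonal characters.

module JacobiTrudi {c ℓ : Level} (R : CommutativeRing c ℓ) where
  open CommutativeRing R hiding (zero)
  open IntegerCoefficients R
  open Determinants R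
  open Recurrences R
  open Factorization R
  open import Relation.Binary.Reasoning.Setoid setoid
  open import Data.List.Relation.Binary.Permutation.Setoid setoid as ↭ using (_↭_; ↭-trans; ↭-prep; ↭-sym)
  open import Data.List.Relation.Binary.Permutation.Setoid.Properties setoid using (∷↭∷ʳ)
  private module ℤS = ℤ.+-*-Solver
  open ℤS using () renaming (_:+_ to _⊕_; _:-_ to _⊝_; :-_ to ⊝_; _:=_ to _≗_)

  module _ (m : ℕ) (μ : Fin m → ℕ) where

    -- With 1-indexed rows and columns these are μᵢ − i + j and μᵢ − i − j + 1.
    α β : Fin m → ℕ → ℤ
    α i j = + μ i ℤ.- + toℕ i ℤ.+ + j
    β i j = + μ i ℤ.- + toℕ i ℤ.- + j ℤ.- + 1

    -- These are the matrices A and B of the overview.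
    forward backward : List Carrier → Matrix m m
    forward zs i j = h R (α i (toℕ j)) zs
    backward zs i j = h R (β i (toℕ j)) zs

  bidiagonal : ∀ n → Matrix n n
  bidiagonal n i j = δ (toℕ i) (toℕ j) - δ (suc (toℕ i)) (toℕ j)

  det-bidiagonal : ∀ n → Det (bidiagonal n) ≈ 1#
  det-bidiagonal zero = refl
  det-bidiagonal (suc n) = begin
    Det (bidiagonal (suc n))
      ≈⟨ det-ᵀ (suc n) (bidiagonal (suc n)) ⟩
    Det (bidiagonal (suc n) ᵀ)
      ≈⟨ det-lowerRow (bidiagonal (suc n) ᵀ) (λ _ → -‿inverseʳ 0#) ⟩
    (1# - 0#) * Det (bidiagonal n ᵀ)
      ≈⟨ *-congˡ (trans (sym (det-ᵀ n (bidiagonal n))) (det-bidiagonal n)) ⟩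
    (1# - 0#) * 1#
      ≈⟨ solve 0 ((con (+ 1) :- con (+ 0)) :* con (+ 1) := con (+ 1)) refl ⟩
    1# ∎

  ⊗-bidiagonal-zero : ∀ {m n} (M : Matrix m (suc n)) i → (M ⊗ bidiagonal (suc n)) i zero ≈ M i zero
  ⊗-bidiagonal-zero {n = n} M i = begin
    ∑ {suc n} (λ k → M i k * (δ (toℕ k) 0 - 0#))
      ≈⟨ ∑-cong {suc n} (λ k → solve 2 (λ a d → a :* (d :- con (+ 0)) := a :* d) refl (M i k) (δ (toℕ k) 0)) ⟩
    ∑ {suc n} (λ k → M i k * 𝟙 k (zero {n}))
      ≈⟨ ∑-𝟙 (M i) zero ⟩
    M i zero ∎

  ⊗-bidiagonal-suc : ∀ {m n} (M : Matrix m (suc n)) i j →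
    (M ⊗ bidiagonal (suc n)) i (suc j) ≈ M i (suc j) - M i (Fin.inject₁ j)
  ⊗-bidiagonal-suc {n = n} M i j = begin
    ∑ {suc n} (λ k → M i k * (δ (toℕ k) (suc (toℕ j)) - δ (toℕ k) (toℕ j)))
      ≈⟨ ∑-cong {suc n} (λ k → trans
           (solve 3 (λ a d e → a :* (d :- e) := (:- con (+ 1)) :* (a :* e) :+ a :* d)
               refl (M i k) (δ (toℕ k) (suc (toℕ j))) (δ (toℕ k) (toℕ j)))
           (+-congʳ (*-congˡ (*-congˡ (reflexive (≡.cong (δ (toℕ k)) (≡.sym (Fin.toℕ-inject₁ j)))))))) ⟩
    ∑ {suc n} (λ k → - 1# * (M i k * 𝟙 k (Fin.inject₁ j)) + M i k * 𝟙 k (suc j))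
      ≈⟨ ∑-linear {suc n} (- 1#) (λ k → M i k * 𝟙 k (Fin.inject₁ j)) (λ k → M i k * 𝟙 k (suc j)) ⟩
    - 1# * ∑ {suc n} (λ k → M i k * 𝟙 k (Fin.inject₁ j)) + ∑ {suc n} (λ k → M i k * 𝟙 k (suc j))
      ≈⟨ +-cong (*-congˡ (∑-𝟙 (M i) (Fin.inject₁ j))) (∑-𝟙 (M i) (suc j)) ⟩
    - 1# * M i (Fin.inject₁ j) + M i (suc j)
      ≈⟨ solve 2 (λ a b → (:- con (+ 1)) :* a :+ b := b :- a) refl _ _ ⟩
    M i (suc j) - M i (Fin.inject₁ j) ∎

  -- Subtracting from each column its predecessor removes the variable 1.
  det-orthogonal : ∀ m (μ : Fin m → ℕ) {V zs} → V ↭ 1# ∷ zs →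
    Det (λ i j → h R (+ μ i ℤ.- + toℕ i ℤ.+ + toℕ j) V - h R (+ μ i ℤ.- + toℕ i ℤ.- + toℕ j ℤ.- + 2) V) ≈
    Det (λ i j → forward m μ zs i j + backward m μ zs i j)
  det-orthogonal zero μ p = refl
  det-orthogonal (suc n) μ {V} {zs} p = begin
    Det M
      ≈⟨ sym (trans (*-congˡ (det-bidiagonal (suc n))) (*-identityʳ _)) ⟩
    Det M * Det (bidiagonal (suc n))
      ≈⟨ sym (det-⊗ M (bidiagonal (suc n))) ⟩
    Det (M ⊗ bidiagonal (suc n))
      ≈⟨ det-cong entry ⟩
    Det (λ i j → forward (suc n) μ zs i j + backward (suc n) μ zs i j) ∎
    where
    r s : ℤ → Carrier
    r k = h R k V
    s k = h R k zs
    M : Matrix (suc n) (suc n)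
    M i j = r (+ μ i ℤ.- + toℕ i ℤ.+ + toℕ j) - r (+ μ i ℤ.- + toℕ i ℤ.- + toℕ j ℤ.- + 2)
    r-step : ∀ k l → k ≡ ℤ.suc l → r k ≈ s k + r l
    r-step k l ≡.refl = trans (h-resp-↭ p k) (trans (h-step 1# zs l)
      (+-congˡ (trans (*-identityˡ _) (sym (h-resp-↭ p l)))))
    entry : M ⊗ bidiagonal (suc n) ≋ (λ i j → forward (suc n) μ zs i j + backward (suc n) μ zs i j)
    -- The first column has no predecessor, but its two indices differ by 2, so removing the
    -- variable 1 twice telescopes to the required two terms.
    entry i zero = begin
      (M ⊗ bidiagonal (suc n)) i zero
        ≈⟨ ⊗-bidiagonal-zero M i ⟩
      r (x ℤ.+ + 0) - r (x ℤ.- + 0 ℤ.- + 2)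
        ≈⟨ +-congʳ (trans (r-step _ (x ℤ.- + 0 ℤ.- + 1) e₁) (+-congˡ (r-step _ (x ℤ.- + 0 ℤ.- + 2) e₂))) ⟩
      (s (x ℤ.+ + 0) + (s (x ℤ.- + 0 ℤ.- + 1) + r (x ℤ.- + 0 ℤ.- + 2))) - r (x ℤ.- + 0 ℤ.- + 2)
        ≈⟨ solve 3 (λ a b c → (a :+ (b :+ c)) :- c := a :+ b) refl _ _ _ ⟩
      s (x ℤ.+ + 0) + s (x ℤ.- + 0 ℤ.- + 1) ∎
      where
      x : ℤ
      x = + μ i ℤ.- + toℕ i
      e₁ : x ℤ.+ + 0 ≡ ℤ.suc (x ℤ.- + 0 ℤ.- + 1)
      e₁ = ℤS.solve 1 (λ x → x ⊕ ℤS.con (+ 0) ≗ ℤS.con (+ 1) ⊕ (x ⊝ ℤS.con (+ 0) ⊝ ℤS.con (+ 1))) ≡.refl x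
      e₂ : x ℤ.- + 0 ℤ.- + 1 ≡ ℤ.suc (x ℤ.- + 0 ℤ.- + 2)
      e₂ = ℤS.solve 1 (λ x → x ⊝ ℤS.con (+ 0) ⊝ ℤS.con (+ 1) ≗
          ℤS.con (+ 1) ⊕ (x ⊝ ℤS.con (+ 0) ⊝ ℤS.con (+ 2))) ≡.refl x
    entry i (suc j) = begin
      (M ⊗ bidiagonal (suc n)) i (suc j)
        ≈⟨ ⊗-bidiagonal-suc M i j ⟩
      (r a - r b) - M i (Fin.inject₁ j)
        ≡⟨ ≡.cong (λ l → (r a - r b) - (r (x ℤ.+ + l) - r (x ℤ.- + l ℤ.- + 2))) (Fin.toℕ-inject₁ j) ⟩
      (r a - r b) - (r a′ - r b′)
        ≈⟨ +-cong (+-congʳ (r-step a a′ e₁)) (-‿cong (+-congˡ (-‿cong (r-step b′ b e₂)))) ⟩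
      ((s a + r a′) - r b) - (r a′ - (s b′ + r b))
        ≈⟨ solve 4 (λ p q u v → ((p :+ q) :- u) :- (q :- (v :+ u)) := p :+ v) refl _ _ _ _ ⟩
      s a + s b′
        ≡⟨ ≡.cong (λ l → s a + s l) e₃ ⟩
      s a + s (x ℤ.- + suc (toℕ j) ℤ.- + 1) ∎
      where
      x a b a′ b′ : ℤ
      x = + μ i ℤ.- + toℕ i
      a = x ℤ.+ + suc (toℕ j)
      b = x ℤ.- + suc (toℕ j) ℤ.- + 2
      a′ = x ℤ.+ + toℕ j
      b′ = x ℤ.- + toℕ j ℤ.- + 2
      e₁ : a ≡ ℤ.suc a′
      e₁ = ℤS.solve 2 (λ x j → x ⊕ (ℤS.con (+ 1) ⊕ j) ≗ ℤS.con (+ 1) ⊕ (x ⊕ j)) ≡.refl x (+ toℕ j)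
      e₂ : b′ ≡ ℤ.suc b
      e₂ = ℤS.solve 2 (λ x j → x ⊝ j ⊝ ℤS.con (+ 2) ≗ ℤS.con (+ 1) ⊕ (x ⊝ (ℤS.con (+ 1) ⊕ j) ⊝ ℤS.con (+ 2)))
          ≡.refl x (+ toℕ j)
      e₃ : b′ ≡ x ℤ.- + suc (toℕ j) ℤ.- + 1
      e₃ = ℤS.solve 2 (λ x j → x ⊝ j ⊝ ℤS.con (+ 2) ≗ x ⊝ (ℤS.con (+ 1) ⊕ j) ⊝ ℤS.con (+ 1)) ≡.refl x (+ toℕ j)

  sgn-+ : ∀ a b → sgn (a ℕ.+ b) ≈ sgn a * sgn b
  sgn-+ zero b = sym (*-identityˡ _)
  sgn-+ (suc a) b = trans (*-congˡ (sgn-+ a b)) (sym (*-assoc _ _ _))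

  ∏-sgn : ∀ m (μ : Fin m → ℕ) → ∏ (λ i → sgn (μ i)) ≈ sgn (size m μ)
  ∏-sgn zero μ = refl
  ∏-sgn (suc m) μ = trans (*-congˡ (∏-sgn m (μ ∘ suc))) (sym (sgn-+ (μ zero) (size m (μ ∘ suc))))

  sgn-square : ∀ m → sgn m * sgn m ≈ 1#
  sgn-square m = trans (sym (sgn-+ m m)) (sgn-even m)

  ∏-one : ∀ {n} {d : Fin n → Carrier} → (∀ i → d i ≈ 1#) → ∏ d ≈ 1#
  ∏-one {zero} eq = refl
  ∏-one {suc n} eq = trans (*-cong (eq zero) (∏-one (eq ∘ suc))) (*-identityˡ 1#)

  -- The signs of the two terms of an entry have exponents μᵢ - i + j and μᵢ - i - j - 1, of
  -- opposite parity, so the sum becomes a difference. The factors (-1)^i from the rows and (-1)^j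
  -- from the columns cancel in the determinant, leaving the product of the (-1)^μᵢ.
  det-negated : ∀ m (μ : Fin m → ℕ) zs →
    Det (λ i j → forward m μ (scale R (- 1#) zs) i j + backward m μ (scale R (- 1#) zs) i j) ≈
    sgn (size m μ) * Det (λ i j → forward m μ zs i j - backward m μ zs i j)
  det-negated m μ zs = begin
    Det (λ i j → forward m μ (scale R (- 1#) zs) i j + backward m μ (scale R (- 1#) zs) i j)
      ≈⟨ det-cong entry ⟩
    Det (λ i j → (sgn (μ i) * sgn (toℕ i)) * (D i j * sgn (toℕ j)))
      ≈⟨ det-scaleRows (λ i → sgn (μ i) * sgn (toℕ i)) (λ i j → D i j * sgn (toℕ j)) ⟩
    ∏ (λ i → sgn (μ i) * sgn (toℕ i)) * Det (λ i j → D i j * sgn (toℕ j))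
      ≈⟨ *-cong (∏-* (sgn ∘ μ) (sgn ∘ toℕ)) (det-scaleColumns (sgn ∘ toℕ) D) ⟩
    (∏ (sgn ∘ μ) * ∏ {m} (sgn ∘ toℕ)) * (∏ {m} (sgn ∘ toℕ) * Det D)
      ≈⟨ solve 3 (λ a b d → (a :* b) :* (b :* d) := a :* ((b :* b) :* d)) refl _ (∏ {m} (sgn ∘ toℕ)) (Det D) ⟩
    ∏ (sgn ∘ μ) * ((∏ {m} (sgn ∘ toℕ) * ∏ {m} (sgn ∘ toℕ)) * Det D)
      ≈⟨ *-cong (∏-sgn m μ) (trans (*-congʳ
          (trans (sym (∏-* {m} (sgn ∘ toℕ) (sgn ∘ toℕ))) (∏-one {m} (λ i → sgn-square (toℕ i))))) (*-identityˡ _)) ⟩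
    sgn (size m μ) * Det D ∎
    where
    D : Matrix m m
    D i j = forward m μ zs i j - backward m μ zs i j
    entry : (λ i j → forward m μ (scale R (- 1#) zs) i j + backward m μ (scale R (- 1#) zs) i j) ≋
            (λ i j → (sgn (μ i) * sgn (toℕ i)) * (D i j * sgn (toℕ j)))
    entry i j = begin
      h R (α m μ i b) (scale R (- 1#) zs) + h R (β m μ i b) (scale R (- 1#) zs)
        ≡⟨ ≡.cong₂ (λ k l → h R k (scale R (- 1#) zs) + h R l (scale R (- 1#) zs)) α≡ β≡ ⟩
      h R ((μ i ℕ.+ b) ℤ.⊖ a) (scale R (- 1#) zs) + h R (μ i ℤ.⊖ suc (a ℕ.+ b)) (scale R (- 1#) zs)
        ≈⟨ +-cong (h-negate zs (μ i ℕ.+ b) a) (h-negate zs (μ i) (suc (a ℕ.+ b))) ⟩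
      sgn (μ i ℕ.+ b ℕ.+ a) * h R ((μ i ℕ.+ b) ℤ.⊖ a) zs + sgn (μ i ℕ.+ suc (a ℕ.+ b)) * h R (μ i ℤ.⊖ suc (a ℕ.+ b)) zs
        ≈⟨ +-cong (*-congʳ (trans (sgn-+ (μ i ℕ.+ b) a) (*-congʳ (sgn-+ (μ i) b))))
                  (*-congʳ (trans (sgn-+ (μ i) (suc (a ℕ.+ b))) (*-congˡ (*-congˡ (sgn-+ a b))))) ⟩
      ((sgn (μ i) * sgn b) * sgn a) * h R ((μ i ℕ.+ b) ℤ.⊖ a) zs +
          (sgn (μ i) * (- 1# * (sgn a * sgn b))) * h R (μ i ℤ.⊖ suc (a ℕ.+ b)) zs
        ≈⟨ solve 5 (λ u b a x y → ((u :* b) :* a) :* x :+ (u :* ((:- con (+ 1)) :* (a :* b))) :* y :=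
            (u :* a) :* ((x :- y) :* b)) refl
             (sgn (μ i)) (sgn b) (sgn a) _ _ ⟩
      (sgn (μ i) * sgn a) * ((h R ((μ i ℕ.+ b) ℤ.⊖ a) zs - h R (μ i ℤ.⊖ suc (a ℕ.+ b)) zs) * sgn b)
        ≡⟨ ≡.cong₂ (λ k l → (sgn (μ i) * sgn a) * ((h R k zs - h R l zs) * sgn b)) (≡.sym α≡) (≡.sym β≡) ⟩
      (sgn (μ i) * sgn a) * (D i j * sgn b) ∎
      where
      a b : ℕ
      a = toℕ i
      b = toℕ j
      α≡ : α m μ i b ≡ (μ i ℕ.+ b) ℤ.⊖ a
      α≡ = ≡.trans (ℤS.solve 3 (λ u a b → u ⊝ a ⊕ b ≗ (u ⊕ b) ⊝ a) ≡.refl (+ μ i) (+ a) (+ b)) (ℤ.m-n≡m⊖n (μ i ℕ.+ b) a)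
      β≡ : β m μ i b ≡ μ i ℤ.⊖ suc (a ℕ.+ b)
      β≡ = ≡.trans (ℤS.solve 3 (λ u a b → u ⊝ a ⊝ b ⊝ ℤS.con (+ 1) ≗ u ⊝ (ℤS.con (+ 1) ⊕ (a ⊕ b)))
          ≡.refl (+ μ i) (+ a) (+ b)) (ℤ.m-n≡m⊖n (μ i) (suc (a ℕ.+ b)))

  -- An index l - i + j with i < N and l, j ≥ 0 exceeds -N. Entries of an N × N Jacobi-Trudi matrix
  -- have this form, so `antisym` agrees with `h` on them.
  reflected-negative : ∀ {N i} → i ℕ.< N → ∀ l j → ∃ λ q → ℤ.- + N ℤ.- (+ l ℤ.- + i ℤ.+ + j) ≡ -[1+ q ]
  reflected-negative {N} {i} i<N l j = d ℕ.+ l ℕ.+ j , ≡.trans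
    (≡.cong (λ n → ℤ.- + n ℤ.- (+ l ℤ.- + i ℤ.+ + j)) (≡.sym (ℕ.m+[n∸m]≡n i<N)))
    (ℤS.solve 4 (λ i d l j → ⊝ ((ℤS.con (+ 1) ⊕ i) ⊕ d) ⊝ (l ⊝ i ⊕ j) ≗ ⊝ (ℤS.con (+ 1) ⊕ ((d ⊕ l) ⊕ j)))
        ≡.refl (+ i) (+ d) (+ l) (+ j))
    where
    d : ℕ
    d = N ℕ.∸ suc i

  +-opposite : ∀ {m} (i : Fin m) → + toℕ (opposite i) ≡ + m ℤ.- + suc (toℕ i)
  +-opposite {m} i = ≡.trans (≡.cong +_ (Fin.opposite-prop i))
    (≡.trans (≡.sym (ℤ.⊖-≥ (Fin.toℕ<n i))) (≡.sym (ℤ.m-n≡m⊖n m (suc (toℕ i)))))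

  μ≤firstPart : ∀ m (μ : Fin m → ℕ) → IsPartition m μ → ∀ k → μ k ℕ.≤ firstPart m μ
  μ≤firstPart (suc m) μ partition k = partition zero k z≤n

  pmPart-↑ˡ : ∀ m (μ : Fin m → ℕ) i → pmPart m μ (i ↑ˡ m) ≡ + firstPart m μ ℤ.+ + μ i
  pmPart-↑ˡ m μ i rewrite Fin.splitAt-↑ˡ m i m = ≡.refl

  pmPart-↑ʳ : ∀ m (μ : Fin m → ℕ) i → pmPart m μ (m ↑ʳ i) ≡ + firstPart m μ ℤ.- + μ (opposite i)
  pmPart-↑ʳ m μ i rewrite Fin.splitAt-↑ʳ m m i = ≡.refl

  -- The monotonicity of `μ` enters here: no part exceeds the first, so the lower half of (±μ) does
  -- not become negative.
  pmPart-nonNegative : ∀ m (μ : Fin m → ℕ) → IsPartition m μ → ∀ i → ∃ λ l → pmPart m μ i ≡ + l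
  pmPart-nonNegative m μ partition i with splitAt m i
  ... | inj₁ k = firstPart m μ ℕ.+ μ k , ≡.refl
  ... | inj₂ k = firstPart m μ ℕ.∸ μ (opposite k) ,
    ≡.trans (ℤ.m-n≡m⊖n (firstPart m μ) (μ (opposite k))) (ℤ.⊖-≥ (μ≤firstPart m μ partition (opposite k)))

  schur-factorization : ∀ m (μ : Fin m → ℕ) → IsPartition m μ → ∀ {Z zs} → ReciprocalPairs m zs → Z ↭ zs →
    schur R (m ℕ.+ m) (pmPart m μ) Z ≈
    Det (λ i j → forward m μ zs i j + backward m μ zs i j) * Det (λ i j → forward m μ zs i j - backward m μ zs i j)
  schur-factorization m μ partition {Z} {zs} pairs Z↭zs = begin
    Det (λ i j → h R (pmPart m μ i ℤ.- + toℕ i ℤ.+ + toℕ j) Z)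
      ≈⟨ det-cong (λ i j → trans (h-resp-↭ Z↭zs (pmPart m μ i ℤ.- + toℕ i ℤ.+ + toℕ j)) (sym (extend i j))) ⟩
    Det (λ i j → f (pmPart m μ i ℤ.- + toℕ i ℤ.+ + toℕ j))
      ≈⟨ det-cong (λ i j → reflexive (≡.cong f (recentre (pmPart m μ i) (+ toℕ i) (+ toℕ j)))) ⟩
    Det (window N f (λ i → + (firstPart m μ ℕ.+ m) ℤ.+ γ i))
      ≈⟨ det-window-+ m (charPoly zs) f recurrent (charPoly-reciprocal pairs) monic (firstPart m μ ℕ.+ m) γ ⟩
    Det (window N f γ)
      ≈⟨ det-centrosymmetric m (forward m μ zs) (backward m μ zs) (window N f γ) ul ur ll lr ⟩
    Det (λ i j → forward m μ zs i j + backward m μ zs i j) * Det (λ i j → forward m μ zs i j - backward m μ zs i j) ∎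
    where
    N : ℕ
    N = m ℕ.+ m
    f : ℤ → Carrier
    f = antisym zs
    -- These are the row indices after the shift by `firstPart m μ + m`. The positions (i, j) and (N
    -- - 1 - i, N - 1 - j) now carry indices with sum -N, so a half-turn of the matrix is the
    -- reflection of `f`.
    γ : Fin N → ℤ
    γ i = pmPart m μ i ℤ.- + firstPart m μ ℤ.- + toℕ i ℤ.- + m
    len : length zs ≡ N
    len = length-reciprocal pairs
    recurrent : Recurrent N (charPoly zs) f
    recurrent = ≡.subst (λ n → Recurrent n (charPoly zs) f) len (antisym-recurrent pairs)
    monic : charPoly zs N ≈ 1#
    monic = trans (reflexive (≡.cong (charPoly zs) (≡.sym len))) (charPoly-monic zs)
    f≈h : ∀ {k} → (∃ λ q → ℤ.- + N ℤ.- k ≡ -[1+ q ]) → f k ≈ h R k zs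
    f≈h {k} (q , eq) = antisym≈h zs k (q , ≡.trans (≡.cong (λ n → ℤ.- + n ℤ.- k) len) eq)
    reflect : ∀ k → f (ℤ.- + N ℤ.- k) ≈ - f k
    reflect k = trans (reflexive (≡.cong (λ n → f (ℤ.- + n ℤ.- k)) (≡.sym len))) (antisym-reflect zs k)
    extend : ∀ i j → f (pmPart m μ i ℤ.- + toℕ i ℤ.+ + toℕ j) ≈ h R (pmPart m μ i ℤ.- + toℕ i ℤ.+ + toℕ j) zs
    extend i j with pmPart m μ i | pmPart-nonNegative m μ partition i
    ... | _ | l , ≡.refl = f≈h (reflected-negative (Fin.toℕ<n i) l (toℕ j))
    recentre : ∀ p i j → p ℤ.- i ℤ.+ j ≡ j ℤ.+ (+ (firstPart m μ ℕ.+ m) ℤ.+ (p ℤ.- + firstPart m μ ℤ.- i ℤ.- + m))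
    recentre p i j = ℤS.solve 5 (λ p i j M m → p ⊝ i ⊕ j ≗ j ⊕ ((M ⊕ m) ⊕ (p ⊝ M ⊝ i ⊝ m)))
        ≡.refl p i j (+ firstPart m μ) (+ m)
    f-α : ∀ i j → f (α m μ i j) ≈ h R (α m μ i j) zs
    f-α i j = f≈h (reflected-negative (ℕ.<-≤-trans (Fin.toℕ<n i) (ℕ.m≤m+n m m)) (μ i) j)
    f-β : ∀ i (j : Fin m) → f (β m μ i (toℕ j)) ≈ h R (β m μ i (toℕ j)) zs
    -- The index is read as μᵢ - (i + j + 1) + 0; since i and j are below m, the number i + j + 1 is
    -- below 2m and plays the part of a row number.
    f-β i j = f≈h (proj₁ neg , ≡.trans (≡.cong (λ k → ℤ.- + N ℤ.- k)
        (ℤS.solve 3 (λ u i j → u ⊝ i ⊝ j ⊝ ℤS.con (+ 1) ≗ u ⊝ (i ⊕ (ℤS.con (+ 1) ⊕ j)) ⊕ ℤS.con (+ 0))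
            ≡.refl (+ μ i) (+ toℕ i) (+ toℕ j)))
        (proj₂ neg))
      where
      neg : ∃ λ q → ℤ.- + N ℤ.- (+ μ i ℤ.- + (toℕ i ℕ.+ suc (toℕ j)) ℤ.+ + 0) ≡ -[1+ q ]
      neg = reflected-negative (ℕ.+-mono-<-≤ (Fin.toℕ<n i) (Fin.toℕ<n j)) (μ i) 0
    γ-↑ˡ : ∀ i → γ (i ↑ˡ m) ≡ + μ i ℤ.- + toℕ i ℤ.- + m
    γ-↑ˡ i = ≡.trans (≡.cong₂ (λ p k → p ℤ.- + firstPart m μ ℤ.- + k ℤ.- + m) (pmPart-↑ˡ m μ i) (Fin.toℕ-↑ˡ i m))
      (ℤS.solve 4 (λ M u i m → (M ⊕ u) ⊝ M ⊝ i ⊝ m ≗ u ⊝ i ⊝ m) ≡.refl (+ firstPart m μ) (+ μ i) (+ toℕ i) (+ m))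
    γ-↑ʳ : ∀ i → γ (m ↑ʳ i) ≡ ℤ.- + μ (opposite i) ℤ.- + toℕ i ℤ.- + m ℤ.- + m
    γ-↑ʳ i = ≡.trans (≡.cong₂ (λ p k → p ℤ.- + firstPart m μ ℤ.- + k ℤ.- + m) (pmPart-↑ʳ m μ i) (Fin.toℕ-↑ʳ m i))
      (ℤS.solve 4 (λ M u i m → (M ⊝ u) ⊝ M ⊝ (m ⊕ i) ⊝ m ≗ ⊝ u ⊝ i ⊝ m ⊝ m)
          ≡.refl (+ firstPart m μ) (+ μ (opposite i)) (+ toℕ i) (+ m))
    index : ∀ {i j b k} → toℕ j ≡ b → γ i ≡ k → window N f γ i j ≡ f (+ b ℤ.+ k)
    index ≡.refl ≡.refl = ≡.refl
    ul : ∀ i j → window N f γ (i ↑ˡ m) (j ↑ˡ m) ≈ backward m μ zs i (opposite j)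
    ul i j = begin
      window N f γ (i ↑ˡ m) (j ↑ˡ m)
        ≡⟨ index (Fin.toℕ-↑ˡ j m) (γ-↑ˡ i) ⟩
      f (+ toℕ j ℤ.+ (+ μ i ℤ.- + toℕ i ℤ.- + m))
        ≡⟨ ≡.cong f (≡.trans
             (ℤS.solve 4 (λ u i j m → j ⊕ (u ⊝ i ⊝ m) ≗ u ⊝ i ⊝ (m ⊝ (ℤS.con (+ 1) ⊕ j)) ⊝ ℤS.con (+ 1))
                 ≡.refl (+ μ i) (+ toℕ i) (+ toℕ j) (+ m))
             (≡.cong (λ o → + μ i ℤ.- + toℕ i ℤ.- o ℤ.- + 1) (≡.sym (+-opposite j)))) ⟩
      f (β m μ i (toℕ (opposite j)))
        ≈⟨ f-β i (opposite j) ⟩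
      backward m μ zs i (opposite j) ∎
    ur : ∀ i j → window N f γ (i ↑ˡ m) (m ↑ʳ j) ≈ forward m μ zs i j
    ur i j = begin
      window N f γ (i ↑ˡ m) (m ↑ʳ j)
        ≡⟨ index (Fin.toℕ-↑ʳ m j) (γ-↑ˡ i) ⟩
      f (+ (m ℕ.+ toℕ j) ℤ.+ (+ μ i ℤ.- + toℕ i ℤ.- + m))
        ≡⟨ ≡.cong f (ℤS.solve 4 (λ u i j m → (m ⊕ j) ⊕ (u ⊝ i ⊝ m) ≗ u ⊝ i ⊕ j)
            ≡.refl (+ μ i) (+ toℕ i) (+ toℕ j) (+ m)) ⟩
      f (α m μ i (toℕ j))
        ≈⟨ f-α i (toℕ j) ⟩
      forward m μ zs i j ∎
    ll : ∀ i j → window N f γ (m ↑ʳ i) (j ↑ˡ m) ≈ - forward m μ zs (opposite i) (opposite j)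
    ll i j = begin
      window N f γ (m ↑ʳ i) (j ↑ˡ m)
        ≡⟨ index (Fin.toℕ-↑ˡ j m) (γ-↑ʳ i) ⟩
      f (+ toℕ j ℤ.+ (ℤ.- + μ (opposite i) ℤ.- + toℕ i ℤ.- + m ℤ.- + m))
        ≡⟨ ≡.cong f (≡.trans
             (ℤS.solve 4 (λ u i j m → j ⊕ (⊝ u ⊝ i ⊝ m ⊝ m) ≗
               ⊝ (m ⊕ m) ⊝ (u ⊝ (m ⊝ (ℤS.con (+ 1) ⊕ i)) ⊕ (m ⊝ (ℤS.con (+ 1) ⊕ j))))
                   ≡.refl (+ μ (opposite i)) (+ toℕ i) (+ toℕ j) (+ m))
             (≡.cong₂ (λ o p → ℤ.- + N ℤ.- (+ μ (opposite i) ℤ.- o ℤ.+ p)) (≡.sym (+-opposite i)) (≡.sym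
                 (+-opposite j)))) ⟩
      f (ℤ.- + N ℤ.- α m μ (opposite i) (toℕ (opposite j)))
        ≈⟨ trans (reflect _) (-‿cong (f-α (opposite i) (toℕ (opposite j)))) ⟩
      - forward m μ zs (opposite i) (opposite j) ∎
    lr : ∀ i j → window N f γ (m ↑ʳ i) (m ↑ʳ j) ≈ - backward m μ zs (opposite i) j
    lr i j = begin
      window N f γ (m ↑ʳ i) (m ↑ʳ j)
        ≡⟨ index (Fin.toℕ-↑ʳ m j) (γ-↑ʳ i) ⟩
      f (+ (m ℕ.+ toℕ j) ℤ.+ (ℤ.- + μ (opposite i) ℤ.- + toℕ i ℤ.- + m ℤ.- + m))
        ≡⟨ ≡.cong f (≡.trans
             (ℤS.solve 4 (λ u i j m → (m ⊕ j) ⊕ (⊝ u ⊝ i ⊝ m ⊝ m) ≗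
               ⊝ (m ⊕ m) ⊝ (u ⊝ (m ⊝ (ℤS.con (+ 1) ⊕ i)) ⊝ j ⊝ ℤS.con (+ 1)))
                   ≡.refl (+ μ (opposite i)) (+ toℕ i) (+ toℕ j) (+ m))
             (≡.cong (λ o → ℤ.- + N ℤ.- (+ μ (opposite i) ℤ.- o ℤ.- + toℕ j ℤ.- + 1)) (≡.sym (+-opposite i)))) ⟩
      f (ℤ.- + N ℤ.- β m μ (opposite i) (toℕ j))
        ≈⟨ trans (reflect _) (-‿cong (f-β (opposite i) j)) ⟩
      - backward m μ zs (opposite i) j ∎

  -- The theorem of Ciucu and Krattenthaler for arbitrary W, in the variables W and their reciprocals V.
  schur-oo-oo : ∀ m (μ : Fin m → ℕ) → IsPartition m μ → ∀ {W V W⁻ V⁻ Z zs} →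
    ReciprocalPairs m zs → Z ↭ zs → W ++ V ↭ zs → W⁻ ++ V⁻ ↭ scale R (- 1#) zs →
    schur R (m ℕ.+ m) (pmPart m μ) Z ≈ sgn (size m μ) * (oo R m μ W V * oo R m μ W⁻ V⁻)
  schur-oo-oo m μ partition {W} {V} {W⁻} {V⁻} {Z} {zs} pairs Z↭ W↭ W⁻↭ = begin
    schur R (m ℕ.+ m) (pmPart m μ) Z
      ≈⟨ schur-factorization m μ partition pairs Z↭ ⟩
    Det S * Det D
      ≈⟨ sym (*-identityˡ _) ⟩
    1# * (Det S * Det D)
      -- One copy of (-1)^|μ| stays in front, the other converts det(A - B) into the character at
      -- the negated variables.
      ≈⟨ *-congʳ (sym (sgn-square (size m μ))) ⟩
    (σ * σ) * (Det S * Det D)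
      ≈⟨ solve 3 (λ s a b → (s :* s) :* (a :* b) := s :* (a :* (s :* b))) refl σ (Det S) (Det D) ⟩
    σ * (Det S * (σ * Det D))
      ≈⟨ *-congˡ (*-cong (sym (det-orthogonal m μ (one-first W V W↭)))
                         (sym (trans (det-orthogonal m μ (one-first W⁻ V⁻ W⁻↭)) (det-negated m μ zs)))) ⟩
    σ * (oo R m μ W V * oo R m μ W⁻ V⁻) ∎
    where
    σ : Carrier
    σ = sgn (size m μ)
    S D : Matrix m m
    S i j = forward m μ zs i j + backward m μ zs i j
    D i j = forward m μ zs i j - backward m μ zs i j
    one-first : ∀ A B {C} → A ++ B ↭ C → A ++ B ++ (1# ∷ []) ↭ 1# ∷ C
    one-first A B p = ↭-trans (↭.↭-reflexive (≡.sym (List.++-assoc A B (1# ∷ []))))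
      (↭-trans (↭-sym (∷↭∷ʳ 1# (A ++ B))) (↭-prep 1# p))

-- Rearranging the variables multiplied by roots of unity.

module RootsOfUnity {c ℓ : Level} (R : CommutativeRing c ℓ) where
  open CommutativeRing R hiding (zero)
  open IntegerCoefficients R
  open Determinants R
  open Recurrences R
  open JacobiTrudi R
  open import Relation.Binary.Reasoning.Setoid setoid
  open import Data.List.Relation.Binary.Permutation.Setoid setoid as ↭ using (_↭_; ↭-refl; ↭-trans; ↭-prep; ↭-sym)
  open import Data.List.Relation.Binary.Permutation.Setoid.Properties setoid
    using (++⁺; ++⁺ˡ; shifts; ↭-reverse; map⁺; ++-commutativeMonoid)
  open import Algebra.Properties.CommutativeSemigroup
    (CommutativeMonoid.commutativeSemigroup ++-commutativeMonoid) using (interchange)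

  -- Any list of scalars is allowed in place of consecutive powers, so that a permutation of the
  -- scalars can be carried over to the blocks.
  blocks : List Carrier → List Carrier → List Carrier
  blocks cs Y = List.concat (List.map (λ a → scale R a Y) cs)

  powBlocks≡blocks : ∀ t ω Y → powBlocks R t ω Y ≡ blocks (List.map (pow R ω) (List.upTo t)) Y
  powBlocks≡blocks t ω Y = ≡.cong List.concat (List.map-∘ (List.upTo t))

  scale-cong : ∀ {a b} → a ≈ b → ∀ Y → scale R a Y ↭ scale R b Y
  scale-cong a≈b Y = ↭.refl (Pointwise.map⁺ _ _ (Pointwise.refl (*-congʳ a≈b)))

  blocks-cong : ∀ {cs ds} → Pointwise _≈_ cs ds → ∀ Y → blocks cs Y ↭ blocks ds Y
  blocks-cong [] Y = ↭-refl
  blocks-cong (eq ∷ eqs) Y = ++⁺ (scale-cong eq Y) (blocks-cong eqs Y)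

  blocks-resp-↭ : ∀ {cs ds} → cs ↭ ds → ∀ Y → blocks cs Y ↭ blocks ds Y
  blocks-resp-↭ (↭.refl eqs) Y = blocks-cong eqs Y
  blocks-resp-↭ (↭.prep eq p) Y = ++⁺ (scale-cong eq Y) (blocks-resp-↭ p Y)
  blocks-resp-↭ (↭.swap {x = x} {y} eq₁ eq₂ p) Y = ↭-trans (shifts (scale R x Y) (scale R y Y))
    (++⁺ (scale-cong eq₂ Y) (++⁺ (scale-cong eq₁ Y) (blocks-resp-↭ p Y)))
  blocks-resp-↭ (↭.trans p q) Y = ↭-trans (blocks-resp-↭ p Y) (blocks-resp-↭ q Y)

  blocks-++ : ∀ cs X Y → blocks cs (X ++ Y) ↭ blocks cs X ++ blocks cs Y
  blocks-++ [] X Y = ↭-refl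
  blocks-++ (a ∷ cs) X Y = ↭-trans
    (++⁺ (↭.↭-reflexive (List.map-++ (a *_) X Y)) (blocks-++ cs X Y))
    (interchange (scale R a X) (scale R a Y) (blocks cs X) (blocks cs Y))

  blocks-scale : ∀ a cs Y → blocks cs (scale R a Y) ↭ scale R a (blocks cs Y)
  blocks-scale a [] Y = ↭-refl
  blocks-scale a (b ∷ cs) Y = ↭-trans (++⁺ (commute Y) (blocks-scale a cs Y))
    (↭.↭-reflexive (≡.sym (List.map-++ (a *_) (scale R b Y) (blocks cs Y))))
    where
    commute : ∀ Y → scale R b (scale R a Y) ↭ scale R a (scale R b Y)
    commute [] = ↭-refl
    commute (y ∷ Y) = ↭.prep (solve 3 (λ a b y → b :* (a :* y) := a :* (b :* y)) refl a b y) (commute Y)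

  length-blocks : ∀ cs Y → length (blocks cs Y) ≡ length cs ℕ.* length Y
  length-blocks [] Y = ≡.refl
  length-blocks (a ∷ cs) Y = ≡.trans (List.length-++ (scale R a Y))
    (≡.cong₂ ℕ._+_ (List.length-map (a *_) Y) (length-blocks cs Y))

  length-powBlocks : ∀ t ω Y → length (powBlocks R t ω Y) ≡ t ℕ.* length Y
  length-powBlocks t ω Y = ≡.trans (≡.cong length (powBlocks≡blocks t ω Y))
    (≡.trans (length-blocks (List.map (pow R ω) (List.upTo t)) Y)
      (≡.cong (ℕ._* length Y) (≡.trans (List.length-map (pow R ω) (List.upTo t)) (List.length-upTo t))))

  pow-+ : ∀ a m n → pow R a (m ℕ.+ n) ≈ pow R a m * pow R a n
  pow-+ a zero n = sym (*-identityˡ _)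
  pow-+ a (suc m) n = trans (*-congˡ (pow-+ a m n)) (sym (*-assoc _ _ _))

  pow-inverse : ∀ {a b} → a * b ≈ 1# → ∀ k → pow R a k * pow R b k ≈ 1#
  pow-inverse ab≈1 zero = *-identityˡ 1#
  pow-inverse {a} {b} ab≈1 (suc k) = begin
    (a * pow R a k) * (b * pow R b k)
      ≈⟨ solve 4 (λ a p b q → (a :* p) :* (b :* q) := (a :* b) :* (p :* q)) refl a (pow R a k) b (pow R b k) ⟩
    (a * b) * (pow R a k * pow R b k)
      ≈⟨ *-cong ab≈1 (pow-inverse ab≈1 k) ⟩
    1# * 1#
      ≈⟨ *-identityˡ 1# ⟩
    1# ∎

  powBlocks-reciprocal : ∀ t {a b X Y} → a * b ≈ 1# → Pointwise (λ x y → x * y ≈ 1#) X Y →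
    Pointwise (λ x y → x * y ≈ 1#) (powBlocks R t a X) (powBlocks R t b Y)
  powBlocks-reciprocal t {a} {b} {X} {Y} ab≈1 XY≈1 =
    Pointwise.concat⁺ (Pointwise.map⁺ _ _ (Pointwise.refl
      (λ {k} → Pointwise.map⁺ _ _ (Pointwise.map (block k) XY≈1)) {List.upTo t}))
    where
    block : ∀ k {x y} → x * y ≈ 1# → (pow R a k * x) * (pow R b k * y) ≈ 1#
    block k {x} {y} xy≈1 = begin
      (pow R a k * x) * (pow R b k * y)
        ≈⟨ solve 4 (λ p x q y → (p :* x) :* (q :* y) := (p :* q) :* (x :* y)) refl (pow R a k) x (pow R b k) y ⟩
      (pow R a k * pow R b k) * (x * y)
        ≈⟨ *-cong (pow-inverse ab≈1 k) xy≈1 ⟩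
      1# * 1#
        ≈⟨ *-identityˡ 1# ⟩
      1# ∎

  applyUpTo≋applyDownFrom : ∀ n {f g : ℕ → Carrier} → (∀ i j → suc (i ℕ.+ j) ≡ n → f i ≈ g j) →
    Pointwise _≈_ (List.applyUpTo f n) (List.applyDownFrom g n)
  applyUpTo≋applyDownFrom zero eq = []
  applyUpTo≋applyDownFrom (suc n) eq =
    eq 0 n ≡.refl ∷ applyUpTo≋applyDownFrom n (λ i j i+j≡n → eq (suc i) j (≡.cong suc i+j≡n))

  -- Inversion permutes the t-th roots of unity ω⁰, …, ω^(t-1): it fixes 1 and reverses the others.
  powers-inverse : ∀ t {a b} → pow R a t ≈ 1# → a * b ≈ 1# →
    List.map (pow R a) (List.upTo t) ↭ List.map (pow R b) (List.upTo t)
  powers-inverse zero aᵗ≈1 ab≈1 = ↭-refl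
  powers-inverse (suc t) {a} {b} aᵗ≈1 ab≈1 = ↭-trans (↭.↭-reflexive (List.map-upTo (pow R a) (suc t)))
    (↭-trans (↭-prep 1# tails) (↭.↭-reflexive (≡.sym (List.map-upTo (pow R b) (suc t)))))
    where
    -- The order of the root is `suc t` here, and the exponents i + 1 and j + 1 add up to it.
    inverse-power : ∀ i j → suc (i ℕ.+ j) ≡ t → pow R b (suc i) ≈ pow R a (suc j)
    inverse-power i j i+j≡t = begin
      pow R b (suc i)
        ≈⟨ sym (*-identityʳ _) ⟩
      pow R b (suc i) * 1#
        ≈⟨ *-congˡ (sym aᵗ≈1) ⟩
      pow R b (suc i) * pow R a (suc t)
        ≡⟨ ≡.cong (λ k → pow R b (suc i) * pow R a k)
            (≡.trans (≡.cong suc (≡.sym i+j≡t)) (≡.cong suc (≡.sym (ℕ.+-suc i j)))) ⟩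
      pow R b (suc i) * pow R a (suc i ℕ.+ suc j)
        ≈⟨ *-congˡ (pow-+ a (suc i) (suc j)) ⟩
      pow R b (suc i) * (pow R a (suc i) * pow R a (suc j))
        ≈⟨ solve 3 (λ p q r → p :* (q :* r) := (q :* p) :* r)
            refl (pow R b (suc i)) (pow R a (suc i)) (pow R a (suc j)) ⟩
      (pow R a (suc i) * pow R b (suc i)) * pow R a (suc j)
        ≈⟨ *-congʳ (pow-inverse ab≈1 (suc i)) ⟩
      1# * pow R a (suc j)
        ≈⟨ *-identityˡ _ ⟩
      pow R a (suc j) ∎
    tails : List.applyUpTo (pow R a ∘ suc) t ↭ List.applyUpTo (pow R b ∘ suc) t
    tails = ↭-trans (↭-sym (↭-reverse (List.applyUpTo (pow R a ∘ suc) t)))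
      (↭-trans (↭.↭-reflexive (List.reverse-applyUpTo (pow R a ∘ suc) t))
        (↭-sym (↭.refl (applyUpTo≋applyDownFrom t inverse-power))))

  -- The Schur function contains the products of the powers of ω with 1/x, whereas the reciprocals
  -- of the ωᵏx carry the powers of 1/ω. The two lists differ only in order, which `h` does not see.
  powBlocks-inverse : ∀ t {a b} → pow R a t ≈ 1# → a * b ≈ 1# → ∀ Y → powBlocks R t a Y ↭ powBlocks R t b Y
  powBlocks-inverse t {a} {b} aᵗ≈1 ab≈1 Y rewrite powBlocks≡blocks t a Y | powBlocks≡blocks t b Y =
    blocks-resp-↭ (powers-inverse t aᵗ≈1 ab≈1) Y

  powBlocks-++ : ∀ t a X Y → powBlocks R t a (X ++ Y) ↭ powBlocks R t a X ++ powBlocks R t a Y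
  powBlocks-++ t a X Y rewrite powBlocks≡blocks t a (X ++ Y) | powBlocks≡blocks t a X | powBlocks≡blocks t a Y =
    blocks-++ (List.map (pow R a) (List.upTo t)) X Y

  powBlocks-scale : ∀ t a b Y → powBlocks R t a (scale R b Y) ↭ scale R b (powBlocks R t a Y)
  powBlocks-scale t a b Y rewrite powBlocks≡blocks t a (scale R b Y) | powBlocks≡blocks t a Y =
    blocks-scale b (List.map (pow R a) (List.upTo t)) Y

  -- The size m is a variable tied to `t * length X` by an equation, because `length (tabulate x)`
  -- is n only propositionally; thus `μ` is never transported, only the evidence of the pairing.
  schur-powBlocks : ∀ t {ω ω⁻¹} → pow R ω t ≈ 1# → ω * ω⁻¹ ≈ 1# → ∀ {X Y} → Pointwise (λ x y → x * y ≈ 1#) X Y →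
    ∀ m → m ≡ t ℕ.* length X → (μ : Fin m → ℕ) → IsPartition m μ →
    schur R (m ℕ.+ m) (pmPart m μ) (powBlocks R t ω (X ++ Y)) ≈
    sgn (size m μ) * (oo R m μ (powBlocks R t ω X) (powBlocks R t ω⁻¹ Y) *
      oo R m μ (powBlocks R t ω (scale R (- 1#) X)) (powBlocks R t ω⁻¹ (scale R (- 1#) Y)))
  schur-powBlocks t {ω} {ω⁻¹} ωᵗ≈1 ωω⁻¹≈1 {X} {Y} XY≈1 m m≡ μ partition =
    schur-oo-oo m μ partition {W} {V} {powBlocks R t ω (scale R (- 1#) X)} {powBlocks R t ω⁻¹ (scale R (- 1#) Y)}
      (≡.subst (λ k → ReciprocalPairs k zs) (≡.trans (length-powBlocks t ω X) (≡.sym m≡)) (proj₁ (proj₂ pairs)))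
      (↭-trans (powBlocks-++ t ω X Y) (↭-trans (++⁺ˡ W (powBlocks-inverse t ωᵗ≈1 ωω⁻¹≈1 Y)) W++V↭zs))
      W++V↭zs
      (↭-trans (++⁺ (powBlocks-scale t ω (- 1#) X) (powBlocks-scale t ω⁻¹ (- 1#) Y))
        (↭-trans (↭.↭-reflexive (≡.sym (List.map-++ (- 1# *_) W V))) (map⁺ setoid *-congˡ W++V↭zs)))
    where
    W V : List Carrier
    W = powBlocks R t ω X
    V = powBlocks R t ω⁻¹ Y
    pairs : ∃ λ zs → ReciprocalPairs (length W) zs × (W ++ V ↭ zs)
    pairs = interleave (powBlocks-reciprocal t ωω⁻¹≈1 XY≈1)
    zs : List Carrier
    zs = proj₁ pairs
    W++V↭zs : W ++ V ↭ zs
    W++V↭zs = proj₂ (proj₂ pairs)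

open import Data.Nat using (_≤_; _*_; _+_; _∸_)

theorem4p8 : {c ℓ : Level} (F : CommutativeRing c ℓ) → IsFieldR F →
    (t : ℕ) → 2 ≤ t → (ω : CommutativeRing.Carrier F) → IsPrimitiveRoot F t ω →
    (n : ℕ) → 1 ≤ n →
    (x xinv : Fin n → CommutativeRing.Carrier F) →
    ((i : Fin n) → CommutativeRing._≈_ F (CommutativeRing._*_ F (x i) (xinv i)) (CommutativeRing.1# F)) →
    (μ : Fin (t * n) → ℕ) → IsPartition (t * n) μ →
    CommutativeRing._≈_ F
    (schur F (t * n + t * n) (pmPart (t * n) μ) (powBlocks F t ω (tabulate x ++ tabulate xinv)))
    (CommutativeRing._*_ F
    (pow F (CommutativeRing.-_ F (CommutativeRing.1# F)) (size (t * n) μ))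
    (CommutativeRing._*_ F
    (oo F (t * n) μ (powBlocks F t ω (tabulate x))
    (powBlocks F t (pow F ω (t ∸ 1)) (tabulate xinv)))
    (oo F (t * n) μ (powBlocks F t ω (scale F (CommutativeRing.-_ F (CommutativeRing.1# F)) (tabulate x)))
    (powBlocks F t (pow F ω (t ∸ 1)) (scale F (CommutativeRing.-_ F (CommutativeRing.1# F)) (tabulate xinv))))))
theorem4p8 F _ (suc t) _ ω (ωᵗ≈1 , _) n _ x xinv x*xinv≈1 μ partition =
  -- For order `suc t` the inverse `pow ω (suc t ∸ 1)` reduces to `pow ω t`, and ω times it is
  -- `pow ω (suc t)` by definition. One proof therefore serves both as the root-of-unity equation
  -- and as the equation for the inverse.
  schur-powBlocks (suc t) ωᵗ≈1 ωᵗ≈1 (Pointwise.tabulate⁺ x*xinv≈1) (suc t * n)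
    (≡.cong (suc t *_) (≡.sym (List.length-tabulate x))) μ partition
  where open RootsOfUnity F
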